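{- Let $G$ be a finite simple graph with totally ordered vertex set $I=\{\alpha_1<\dots<\alpha_n\}$, let $\lambda$ be a positive integer and $0\le m\le n$ an integer. Then $\widetilde{\chi}_G^{(m)}(\lambda)$ equals the number of $(m,\lambda)$-labelled acyclic orientations of $G$.
   Context: $\chi_G(q)$ is the chromatic polynomial of $G$, $\chi_G^{(m)}$ its $m$-th derivative, and $\widetilde{\chi}_G^{(m)}(q):=(-1)^{n-m}\chi_G^{(m)}(-q)$. Heaps: two vertices commute if they are distinct and non-adjacent. The heap monoid is the quotient of the free monoid on $I$ by the congruence generated by $ab=ba$ for commuting $a,b$, with product $\circ$ induced by concatenation. For a word $p_1\cdots p_r$ its pieces are partially ordered by the transitive closure of $p_s<p_t$ when $s<t$ and $p_s,p_t$ are equal or adjacent; this poset depends only on the heap; $\pi(E)$ is the set of positions of pieces of $E$. A heap is multilinear if each vertex occurs exactly once. Order words lexicographically (proper prefix smaller); $\operatorname{st}(E)$ is the largest word representing $E$ and $E\le F$ iff $\operatorname{st}(E)\le\operatorname{st}(F)$. $E$ is primitive if $E=U\circ V=V\circ U$ forces $U$ or $V$ empty; conjugacy is the transitive closure of $U\circ V\mapsto V\circ U$; a Lyndon heap is nonempty, primitive and minimal in its conjugacy class. Every heap factors uniquely as $E=E_1\circ\cdots\circ E_k$ with $E_i$ Lyndon and $E_1\ge\dots\ge E_k$ (Lyndon factorization). For a multilinear heap $E$ with Lyndon factorization $E_1\circ\cdots\circ E_k$, an $(m,\lambda)$-labelling of $E$ (possible only when $k\ge m$) is a function $f:I\to\mathbb{N}$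 constant on each $\pi(E_j)$, whose value on $\pi(E_j)$ lies in $\{1,\dots,k-j+1\}$ for $1\le j\le m$ and in $\{1,\dots,\lambda\}$ for $m<j\le k$. Each multilinear heap $E$ gives an acyclic orientation $\mathcal{O}_E$ of $G$ (edge $\{\alpha,\beta\}$ oriented $\alpha\to\beta$ iff piece $\alpha$ lies below $\beta$ in $E$), and $E\mapsto\mathcal{O}_E$ is a bijection onto the acyclic orientations of $G$. An $(m,\lambda)$-labelled acyclic orientation is a pair $(\mathcal{O}_E,f)$ with $f$ an $(m,\lambda)$-labelling of $E$. -}

module Defs where

open import Data.Bool using (Bool; true; false; _∧_; if_then_else_; T)
open import Data.Nat as ℕ using (ℕ; zero; suc; _≤_; _<_)
open import Data.Fin as Fin using (Fin)
open import Data.Fin.Properties using (_≟_)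
open import Data.Integer as ℤ using (ℤ; +_)
open import Data.List using (List; []; _∷_; _++_; concat; length; allFin)
open import Data.List.Membership.Propositional using (_∈_)
open import Data.List.Relation.Unary.All using (All)
open import Data.List.Relation.Unary.Linked using (Linked)
open import Data.List.Relation.Unary.Unique.Propositional using (Unique)
open import Data.List.Relation.Binary.Permutation.Propositional using (_↭_)
open import Data.Vec using (Vec; tabulate; lookup)
open import Data.Product using (Σ; _×_; _,_)
open import Data.Sum using (_⊎_)
open import Data.Unit using (⊤)
open import Function.Bundles using (_⇔_)
open import Relation.Nullary using (¬_; does)
open import Relation.Binary.PropositionalEquality using (_≡_; _≢_)
open import Relation.Binary.Construct.Closure.Equivalence using (EqClosure)
open import Relation.Binary.Construct.Closure.ReflexiveTransitive using (Star)

Card : {A : Set} → (A → Set) → ℕ → Set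
Card {A} P N = Σ (List A) λ L → Unique L × (∀ x → (x ∈ L) ⇔ P x) × length L ≡ N

-- Finite simple graphs on the totally ordered vertex set Fin n
-- (α₁ < … < αₙ is Fin.zero < … < Fin.fromℕ (n-1)).

record Graph (n : ℕ) : Set where
  field
    adj    : Fin n → Fin n → Bool
    sym    : ∀ a b → adj a b ≡ adj b a
    irrefl : ∀ a → adj a a ≡ false
open Graph public

Poly : Set
Poly = List ℤ

eval : Poly → ℤ → ℤ
eval []       x = + 0
eval (c ∷ cs) x = c ℤ.+ x ℤ.* eval cs x

derivFrom : ℕ → Poly → Poly
derivFrom k []       = []
derivFrom k (c ∷ cs) = (+ k) ℤ.* c ∷ derivFrom (suc k) cs

deriv : Poly → Poly
deriv []       = []
deriv (c ∷ cs) = derivFrom 1 cs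

derivN : ℕ → Poly → Poly
derivN zero    p = p
derivN (suc m) p = deriv (derivN m p)

ProperColouring : ∀ {n} → Graph n → (q : ℕ) → Vec (Fin q) n → Set
ProperColouring G q c = ∀ a b → T (adj G a b) → lookup c a ≢ lookup c b

-- P is the chromatic polynomial of G: P(q) = number of proper q-colourings
-- for every q ∈ ℕ (this determines P as a polynomial function).
IsChromaticPolynomial : ∀ {n} → Graph n → Poly → Set
IsChromaticPolynomial G P =
  ∀ q → Σ ℕ λ N → Card (ProperColouring G q) N × eval P (+ q) ≡ + N

chiTilde : (n m : ℕ) → Poly → ℤ → ℤ
chiTilde n m P q = (ℤ.-[1+ 0 ] ℤ.^ (n ℕ.∸ m)) ℤ.* eval (derivN m P) (ℤ.- q)

module _ {n : ℕ} (G : Graph n) where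

  Word : Set
  Word = List (Fin n)

  Commute : Fin n → Fin n → Set
  Commute a b = a ≢ b × adj G a b ≡ false

  data Swap : Word → Word → Set where
    swap : ∀ u v a b → Commute a b → Swap (u ++ a ∷ b ∷ v) (u ++ b ∷ a ∷ v)

  -- the congruence generated by ab = ba (two words represent the same heap)
  _~_ : Word → Word → Set
  _~_ = EqClosure Swap

  data _≤lex_ : Word → Word → Set where
    []≤   : ∀ {w} → [] ≤lex w
    head< : ∀ {a b u v} → a Fin.< b → (a ∷ u) ≤lex (b ∷ v)
    head≡ : ∀ {a u v} → u ≤lex v → (a ∷ u) ≤lex (a ∷ v)

  IsSt : Word → Word → Set
  IsSt w s = (s ~ w) × (∀ s' → s' ~ w → s' ≤lex s)

  _≤H_ : Word → Word → Set
  u ≤H v = ∀ su sv → IsSt u su → IsSt v sv → su ≤lex sv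

  Primitive : Word → Set
  Primitive w = ∀ u v → w ~ (u ++ v) → w ~ (v ++ u) → (u ≡ []) ⊎ (v ≡ [])

  Conj₁ : Word → Word → Set
  Conj₁ w w' = Σ Word λ u → Σ Word λ v → (w ~ (u ++ v)) × (w' ~ (v ++ u))

  -- conjugacy (transitive closure; reflexivity is included, U = ∅)
  Conj : Word → Word → Set
  Conj = Star Conj₁

  Lyndon : Word → Set
  Lyndon w = (w ≢ []) × Primitive w × (∀ w' → Conj w w' → w ≤H w')

  LyndonFactorization : Word → List Word → Set
  LyndonFactorization w es =
    (w ~ concat es) × All Lyndon es × Linked (λ x y → y ≤H x) es

  Multilinear : Word → Set
  Multilinear w = w ↭ allFin n

  -- piece a lies before piece b in the word (for adjacent a, b of a
  -- multilinear heap this is exactly "a below b" in the heap poset)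
  before : Word → Fin n → Fin n → Bool
  before []       a b = false
  before (x ∷ xs) a b =
    if does (x ≟ a) then true else (if does (x ≟ b) then false else before xs a b)

  -- orientation as a directed adjacency matrix: entry (a,b) true iff edge a → b
  Orientation : Set
  Orientation = Vec (Vec Bool n) n

  orientOf : Word → Orientation
  orientOf w = tabulate λ a → tabulate λ b → adj G a b ∧ before w a b

  -- conditions on the factors E_j, E_{j+1}, … (j is the 1-based index)
  LabelCond : (m lam k : ℕ) → Vec ℕ n → ℕ → List Word → Set
  LabelCond m lam k f j []       = ⊤
  LabelCond m lam k f j (e ∷ es) =
    (∀ a b → a ∈ e → b ∈ e → lookup f a ≡ lookup f b) ×
    (∀ a → a ∈ e → 1 ≤ lookup f a ×
                   (j ≤ m → lookup f a ≤ k ℕ.∸ j ℕ.+ 1) ×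
                   (m < j → lookup f a ≤ lam)) ×
    LabelCond m lam k f (suc j) es

  IsLabelling : (m lam : ℕ) → Word → Vec ℕ n → Set
  IsLabelling m lam w f =
    Σ (List Word) λ es → LyndonFactorization w es × m ≤ length es ×
      LabelCond m lam (length es) f 1 es

  IsLabelledAO : (m lam : ℕ) → Orientation × Vec ℕ n → Set
  IsLabelledAO m lam (O , f) =
    Σ Word λ w → Multilinear w × O ≡ orientOf w × IsLabelling m lam w f

{-# OPTIONS --safe #-}

-- A multilinear heap is Lyndon iff it is a pyramid over its least vertex x, i.e. x is its only minimal
-- piece: every connected heap is conjugate to such a pyramid, and counting how often each vertex is
-- moved from the bottom to the top shows that conjugate pyramids over the same vertex are equal.
-- Hence the last Lyndon factor of a heap is the up-set of its least vertex x, and a heap is found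
-- letter by letter: a vertex y adjacent to a letter already taken either is the next letter of the
-- factor or is postponed.
-- Proper q-colourings obey the same recursion.  By symmetry they are q times those giving x the
-- colour 0, which amount to colourings of the other vertices avoiding 0 on the neighbours of x; and
-- the colourings avoiding 0 at y are all colourings minus those with colour 0 at y, whose restrictions
-- avoid 0 on the neighbours of y.  So every letter but the first of a factor contributes a sign, and
-- χ(q) = Σ_E (-1)^(n - k(E)) q^(k(E)), where E runs over the multilinear heaps and k(E) is the number
-- of Lyndon factors.  Finally k (k - 1) ⋯ (k - m + 1) λ^(k - m) is both the m-th derivative of q^k at λ
-- and the number of (m, λ)-labellings of a heap with k Lyndon factors.

module Submission where

open import Defs
open import Data.Nat using (ℕ; _≤_)
open import Data.Integer using (+_)
open import Data.Product using (Σ; _×_)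
open import Relation.Binary.PropositionalEquality using (_≡_)

open import Algebra.Bundles using (module AbelianGroup)
open import Data.Bool using (true; false; T; _∧_)
open import Data.Bool.Properties using (T?)
open import Data.Empty using (⊥-elim)
open import Data.Fin as Fin using (Fin)
open import Data.Fin.Permutation.Components using (transpose; transpose-inverse)
import Data.Fin.Properties as Fin
open import Data.Integer as ℤ using (ℤ; -[1+_]; ∣_∣; _+_; _*_; -_; _-_; _^_)
import Data.Integer.Properties as ℤ
open import Data.Integer.Solver using (module +-*-Solver)
open import Data.List
  using (List; []; _∷_; _++_; length; map; filter; concat; reverse; _ʳ++_; drop; upTo; allFin)
open import Data.List.Membership.DecPropositional using () renaming (_∈?_ to member?)
open import Data.List.Membership.Propositional using (_∈_; _∉_; find; lose)
open import Data.List.Membership.Propositional.Properties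
  using (∈-++⁺ˡ; ∈-++⁺ʳ; ∈-++⁻; ∈-∃++; ∈-map⁺; ∈-map⁻; ∈-filter⁺; ∈-filter⁻; ∈-allFin; ∈-upTo⁺; ∈-upTo⁻)
open import Data.List.Membership.Propositional.Properties.WithK using (unique∧set⇒bag)
open import Data.List.Properties
  using (++-assoc; ++-identityʳ; concat-++; length-++; length-map; length-reverse; length-tabulate; length-upTo;
         reverse-involutive; unfold-reverse)
open import Data.List.Relation.Binary.BagAndSetEquality using (∼bag⇒↭)
open import Data.List.Relation.Binary.Permutation.Propositional as ↭
  using (_↭_; prep; ↭-refl; ↭-sym; ↭-trans)
open import Data.List.Relation.Binary.Permutation.Propositional.Properties
  using (shift; drop-∷; ++-comm; ++⁺ˡ; ++⁺ʳ; ∈-resp-↭; All-resp-↭; ↭-empty-inv; ↭-length; ↭-reverse)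
import Data.List.Relation.Binary.Permutation.Setoid.Properties as ↭ₛ
open import Data.List.Relation.Binary.Pointwise as Pointwise using (Pointwise; []; _∷_; Pointwise-length)
open import Data.List.Relation.Unary.All as All using (All; []; _∷_)
import Data.List.Relation.Unary.All.Properties as All
open import Data.List.Relation.Unary.AllPairs as AllPairs using (AllPairs; []; _∷_)
import Data.List.Relation.Unary.AllPairs.Properties as AllPairs
open import Data.List.Relation.Unary.Any as Any using (Any; here; there)
open import Data.List.Relation.Unary.Linked using (Linked; []; [-]; _∷_)
open import Data.List.Relation.Unary.Unique.Propositional using (Unique)
import Data.List.Relation.Unary.Unique.Propositional.Properties as Unique
import Data.Nat as ℕ
open import Data.Nat using (zero; suc)
open import Data.Nat.ListAction using (sum)
import Data.Nat.Properties as ℕ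
open import Data.Product using (_,_; proj₁; proj₂; ∃; ∃₂)
open import Data.Sum using (_⊎_; inj₁; inj₂; [_,_]′)
open import Data.Unit using (tt)
open import Data.Vec using (Vec; lookup; tabulate; replicate)
open import Data.Vec.Properties using (lookup∘tabulate; tabulate∘lookup; tabulate-cong; lookup-replicate)
open import Function using (_∘_; const)
open import Function.Bundles using (mk⇔; Equivalence)
open import Relation.Binary using (tri<; tri≈; tri>)
open import Relation.Binary.Construct.Closure.ReflexiveTransitive using (ε; _◅_; _◅◅_)
open import Relation.Binary.Construct.Closure.Symmetric using (fwd; bwd)
import Relation.Binary.Construct.Closure.Equivalence as EqClosure
open import Relation.Binary.PropositionalEquality
  using (_≢_; refl; trans; cong; cong₂; subst; subst₂; setoid; module ≡-Reasoning)
  renaming (sym to ≡-sym)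
open import Relation.Nullary using (¬_; ¬?; Dec; yes; no; contradiction; _⊎-dec_)
open import Relation.Nullary.Decidable using (dec-true)
open import Relation.Unary using (Decidable)

open import Algebra.Properties.Group (AbelianGroup.group ℤ.+-0-abelianGroup) using (∙-cancelˡ)
open Equivalence using (to; from)
open +-*-Solver using (solve; _:=_; _:+_; _:*_; :-_; con)

-- Cardinalities of predicates

unique-set⇒↭ : {A : Set} {xs ys : List A} → Unique xs → Unique ys →
               (∀ {x} → x ∈ xs → x ∈ ys) → (∀ {x} → x ∈ ys → x ∈ xs) → xs ↭ ys
unique-set⇒↭ uxs uys f g = ∼bag⇒↭ (unique∧set⇒bag uxs uys (mk⇔ f g))

Card-unique : {A : Set} {P : A → Set} {M N : ℕ} → Card P M → Card P N → M ≡ N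
Card-unique (_ , ul , lP , refl) (_ , uk , kP , refl) =
  ↭-length (unique-set⇒↭ ul uk (λ {x} → from (kP x) ∘ to (lP x)) (λ {x} → from (lP x) ∘ to (kP x)))

Card-resp : {A : Set} {P Q : A → Set} {N : ℕ} →
            (∀ x → P x → Q x) → (∀ x → Q x → P x) → Card P N → Card Q N
Card-resp f g (xs , u , e , l) =
  xs , u , (λ x → mk⇔ (f x ∘ to (e x)) (from (e x) ∘ g x)) , l

Card-∪ : {A : Set} {P Q : A → Set} {M N : ℕ} → (∀ x → P x → ¬ Q x) →
         Card P M → Card Q N → Card (λ x → P x ⊎ Q x) (M ℕ.+ N)
Card-∪ disj (xs , u , e , refl) (ys , v , f , refl) =
  xs ++ ys ,
  Unique.++⁺ u v (λ {x} (i , j) → disj x (to (e x) i) (to (f x) j)) ,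
  (λ x → mk⇔ (λ i → split x (∈-++⁻ xs i))
             λ { (inj₁ p) → ∈-++⁺ˡ (from (e x) p) ; (inj₂ q) → ∈-++⁺ʳ xs (from (f x) q) }) ,
  length-++ xs
  where
  split : ∀ x → x ∈ xs ⊎ x ∈ ys → _
  split x (inj₁ i) = inj₁ (to (e x) i)
  split x (inj₂ j) = inj₂ (to (f x) j)

Card-∅ : {A : Set} {P : A → Set} → (∀ x → ¬ P x) → Card P 0
Card-∅ ¬P = [] , [] , (λ x → mk⇔ (λ ()) (⊥-elim ∘ ¬P x)) , refl

Card-singleton : {A : Set} {P : A → Set} (a : A) → P a → (∀ x → P x → x ≡ a) → Card P 1
Card-singleton a pa only =
  a ∷ [] , [] ∷ [] , (λ x → mk⇔ (λ { (here refl) → pa }) (here ∘ only x)) , refl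

Card-filter : {A : Set} {P Q : A → Set} {N : ℕ} → Decidable Q → Card P N →
              Σ ℕ (Card (λ x → P x × Q x))
Card-filter Q? (xs , u , e , _) =
  length (filter Q? xs) , filter Q? xs , Unique.filter⁺ Q? u ,
  (λ x → mk⇔ (λ i → let (j , q) = ∈-filter⁻ Q? i in to (e x) j , q)
             (λ (p , q) → ∈-filter⁺ Q? (from (e x) p) q)) , refl

Card-split : {A : Set} {P Q : A → Set} {L M N : ℕ} → Decidable Q → Card P L →
             Card (λ x → P x × ¬ Q x) M → Card (λ x → P x × Q x) N → L ≡ M ℕ.+ N
Card-split {P = P} {Q} Q? cP c¬Q cQ =
  Card-unique cP (Card-resp (λ { x (inj₁ pq) → proj₁ pq ; x (inj₂ pq) → proj₁ pq }) back
    (Card-∪ (λ _ p q → proj₂ p (proj₂ q)) c¬Q cQ))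
  where
  back : ∀ x → P x → (P x × ¬ Q x) ⊎ (P x × Q x)
  back x p with Q? x
  ... | yes q = inj₂ (p , q)
  ... | no ¬q = inj₁ (p , ¬q)

Card-image : {A B : Set} {P : A → Set} {Q : B → Set} {N : ℕ} (f : A → B) (g : B → A) →
             (∀ x → P x → Q (f x) × g (f x) ≡ x) → (∀ y → Q y → P (g y) × f (g y) ≡ y) →
             Card P N → Card Q N
Card-image {P = P} {Q} f g PQ QP (xs , u , e , refl) =
  map f xs , unique-map u (All.tabulate (λ {x} → to (e x))) ,
  (λ y → mk⇔ (λ i → let (x , j , eq) = ∈-map⁻ f i in subst Q (≡-sym eq) (proj₁ (PQ x (to (e x) j))))
             (λ q → subst (_∈ map f xs) (proj₂ (QP y q)) (∈-map⁺ f (from (e (g y)) (proj₁ (QP y q)))))) ,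
  length-map f xs
  where
  f-inj : ∀ {x y} → P x → P y → f x ≡ f y → x ≡ y
  f-inj p q eq = trans (≡-sym (proj₂ (PQ _ p))) (trans (cong g eq) (proj₂ (PQ _ q)))
  fresh : ∀ {x ys} → P x → All P ys → All (x ≢_) ys → All (f x ≢_) (map f ys)
  fresh p []       []       = []
  fresh p (q ∷ qs) (n ∷ ns) = (n ∘ f-inj p q) ∷ fresh p qs ns
  unique-map : ∀ {ys} → Unique ys → All P ys → Unique (map f ys)
  unique-map []       []       = []
  unique-map (n ∷ ns) (p ∷ ps) = fresh p ps n ∷ unique-map ns ps

Card-Any : {I A : Set} {R : I → A → Set} {N : I → ℕ} (is : List I) →
           All (λ i → Card (R i) (N i)) is →
           AllPairs (λ i j → ∀ x → R i x → ¬ R j x) is →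
           Card (λ x → Any (λ i → R i x) is) (sum (map N is))
Card-Any []       []       []       = Card-∅ (λ x ())
Card-Any {R = R} (i ∷ is) (c ∷ cs) (d ∷ ds) =
  Card-resp (λ { x (inj₁ r) → here r ; x (inj₂ r) → there r })
            (λ { x (here r) → inj₁ r ; x (there r) → inj₂ r })
            (Card-∪ (λ x r → none r d) c (Card-Any is cs ds))
  where
  none : ∀ {x js} → R i x → All (λ j → ∀ x → R i x → ¬ R j x) js → ¬ Any (λ j → R j x) js
  none r (n ∷ ns) (here r′)  = n _ r r′
  none r (n ∷ ns) (there rs) = none r ns rs
-- Words without repeated letters

Unique-↭ : {A : Set} {u v : List A} → u ↭ v → Unique u → Unique v
Unique-↭ = ↭ₛ.Unique-resp-↭ (setoid _) ∘ ↭.↭⇒↭ₛ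

Unique-head : {A : Set} {a : A} {w : List A} → Unique (a ∷ w) → a ∉ w
Unique-head (n ∷ _) i = All.lookup n i refl

Unique-++⁻ʳ : {A : Set} (u : List A) {v : List A} → Unique (u ++ v) → Unique v
Unique-++⁻ʳ []      u       = u
Unique-++⁻ʳ (a ∷ w) (_ ∷ u) = Unique-++⁻ʳ w u

Unique-++⁻ˡ : {A : Set} (u : List A) {v : List A} → Unique (u ++ v) → Unique u
Unique-++⁻ˡ []      _       = []
Unique-++⁻ˡ (a ∷ w) (n ∷ u) = All.++⁻ˡ w n ∷ Unique-++⁻ˡ w u

Unique-disjoint : {A : Set} (u : List A) {v : List A} {a : A} → Unique (u ++ v) → a ∈ u → a ∉ v
Unique-disjoint (b ∷ u) U       (here refl) j = Unique-head U (∈-++⁺ʳ u j)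
Unique-disjoint (b ∷ u) (_ ∷ U) (there i)   j = Unique-disjoint u U i j

-- Some occurrence of the first letter precedes some occurrence of the second. On words without
-- repeated letters this is a strict total order on the letters; in contrast to `before`, both
-- letters have to occur.
data Bef {A : Set} : List A → A → A → Set where
  here  : ∀ {a b w} → b ∈ w → Bef (a ∷ w) a b
  there : ∀ {a b c w} → Bef w a b → Bef (c ∷ w) a b

bef-∈ˡ : {A : Set} {w : List A} {a b : A} → Bef w a b → a ∈ w
bef-∈ˡ (here _)  = here refl
bef-∈ˡ (there p) = there (bef-∈ˡ p)

bef-∈ʳ : {A : Set} {w : List A} {a b : A} → Bef w a b → b ∈ w
bef-∈ʳ (here i)  = there i
bef-∈ʳ (there p) = there (bef-∈ʳ p)

bef-++ˡ : {A : Set} {u v : List A} {a b : A} → Bef u a b → Bef (u ++ v) a b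
bef-++ˡ (here i)  = here (∈-++⁺ˡ i)
bef-++ˡ (there p) = there (bef-++ˡ p)

bef-++ʳ : {A : Set} (u : List A) {v : List A} {a b : A} → Bef v a b → Bef (u ++ v) a b
bef-++ʳ []      p = p
bef-++ʳ (c ∷ u) p = there (bef-++ʳ u p)

bef-across : {A : Set} {u v : List A} {a b : A} → a ∈ u → b ∈ v → Bef (u ++ v) a b
bef-across {u = _ ∷ u} (here refl) j = here (∈-++⁺ʳ u j)
bef-across              (there i)   j = there (bef-across i j)

bef-++⁻ : {A : Set} (u : List A) {v : List A} {a b : A} → Bef (u ++ v) a b →
          Bef u a b ⊎ (a ∈ u × b ∈ v) ⊎ Bef v a b
bef-++⁻ []      p         = inj₂ (inj₂ p)
bef-++⁻ (c ∷ u) (here i)  with ∈-++⁻ u i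
... | inj₁ j = inj₁ (here j)
... | inj₂ j = inj₂ (inj₁ (here refl , j))
bef-++⁻ (c ∷ u) (there p) with bef-++⁻ u p
... | inj₁ q              = inj₁ (there q)
... | inj₂ (inj₁ (i , j)) = inj₂ (inj₁ (there i , j))
... | inj₂ (inj₂ q)       = inj₂ (inj₂ q)

bef-total : {A : Set} {w : List A} {a b : A} → a ∈ w → b ∈ w → a ≢ b → Bef w a b ⊎ Bef w b a
bef-total (here refl) (here refl) a≢b = contradiction refl a≢b
bef-total (here refl) (there j)   a≢b = inj₁ (here j)
bef-total (there i)   (here refl) a≢b = inj₂ (here i)
bef-total (there i)   (there j)   a≢b with bef-total i j a≢b
... | inj₁ p = inj₁ (there p)
... | inj₂ p = inj₂ (there p)

bef-asym : {A : Set} {w : List A} {a b : A} → Unique w → Bef w a b → ¬ Bef w b a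
bef-asym U       (here i)  (here j)  = Unique-head U i
bef-asym U       (here i)  (there q) = Unique-head U (bef-∈ʳ q)
bef-asym U       (there p) (here j)  = Unique-head U (bef-∈ʳ p)
bef-asym (_ ∷ U) (there p) (there q) = bef-asym U p q

Unique-shift : {A : Set} (p : List A) {a : A} {r : List A} → Unique (p ++ a ∷ r) → Unique (a ∷ p ++ r)
Unique-shift p {a} {r} = Unique-↭ (shift a p r)

∉⇒[] : {A : Set} (w : List A) → (∀ {a} → a ∉ w) → w ≡ []
∉⇒[] []      f = refl
∉⇒[] (a ∷ w) f = contradiction (here refl) f

AllPairs-∈ : ∀ {A : Set} {R S : A → A → Set} {xs} →
             (∀ {x y} → x ∈ xs → y ∈ xs → R x y → S x y) → AllPairs R xs → AllPairs S xs
AllPairs-∈ f []       = []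
AllPairs-∈ f (r ∷ rs) =
  All.tabulate (λ i → f (here refl) (there i) (All.lookup r i)) ∷ AllPairs-∈ (λ i j → f (there i) (there j)) rs

T-ext : ∀ {x y} → (T x → T y) → (T y → T x) → x ≡ y
T-ext {true}  {true}  f g = refl
T-ext {true}  {false} f g = contradiction (f tt) λ ()
T-ext {false} {true}  f g = contradiction (g tt) λ ()
T-ext {false} {false} f g = refl

vec-ext : ∀ {A : Set} {k} {u v : Vec A k} → (∀ a → lookup u a ≡ lookup v a) → u ≡ v
vec-ext {u = u} {v} eq = trans (≡-sym (tabulate∘lookup u)) (trans (tabulate-cong eq) (tabulate∘lookup v))

sum-const : ∀ {A : Set} (xs : List A) c → sum (map (const c) xs) ≡ length xs ℕ.* c
sum-const []       c = refl
sum-const (x ∷ xs) c = cong (c ℕ.+_) (sum-const xs c)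

greatest : ∀ {n} {S : Fin n → Set} → Decidable S → (w : List (Fin n)) →
           (∀ {a} → a ∈ w → ¬ S a) ⊎ (∃ λ a → S a × (∀ {b} → b ∈ w → S b → b Fin.≤ a))
greatest S? [] = inj₁ λ ()
greatest S? (c ∷ w) with S? c | greatest S? w
... | no ¬s | inj₁ none      = inj₁ λ { (here refl) → ¬s ; (there i) → none i }
... | no ¬s | inj₂ (a , s , top) =
  inj₂ (a , s , λ { (here refl) s → contradiction s ¬s ; (there i) → top i })
... | yes s | inj₁ none      =
  inj₂ (c , s , λ { (here refl) _ → Fin.≤-refl ; (there i) s′ → contradiction s′ (none i) })
... | yes s | inj₂ (a , s′ , top) with Fin.≤-total a c
...   | inj₁ a≤c = inj₂ (c , s , λ { (here refl) _ → Fin.≤-refl ; (there i) t → Fin.≤-trans (top i t) a≤c })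
...   | inj₂ c≤a = inj₂ (a , s′ , λ { (here refl) _ → c≤a ; (there i) t → top i t })

least : ∀ {n} (a : Fin n) (w : List (Fin n)) → ∃ λ x → x ∈ a ∷ w × (∀ {b} → b ∈ a ∷ w → x Fin.≤ b)
least a []      = a , here refl , λ { (here refl) → Fin.≤-refl }
least a (c ∷ w) with least c w
... | x , i , low with Fin.≤-total a x
...   | inj₁ a≤x = a , here refl , λ { (here refl) → Fin.≤-refl ; (there j) → Fin.≤-trans a≤x (low j) }
...   | inj₂ x≤a = x , there i , λ { (here refl) → x≤a ; (there j) → low j }

-- Polynomials and their derivatives

coeff : Poly → ℕ → ℤ
coeff []       i       = + 0
coeff (c ∷ cs) zero    = c
coeff (c ∷ cs) (suc i) = coeff cs i

infix 4 _≐_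
_≐_ : Poly → Poly → Set
P ≐ Q = ∀ i → coeff P i ≡ coeff Q i

coeff-drop : ∀ P i → coeff (drop 1 P) i ≡ coeff P (suc i)
coeff-drop []      i = refl
coeff-drop (c ∷ P) i = refl

eval-head : ∀ P x → eval P x ≡ coeff P 0 + x * eval (drop 1 P) x
eval-head []      x = solve 1 (λ x → con (+ 0) := con (+ 0) :+ x :* con (+ 0)) refl x
eval-head (c ∷ P) x = refl

eval-cong : ∀ P Q → P ≐ Q → ∀ x → eval P x ≡ eval Q x
eval-cong []      []      e x = refl
eval-cong []      (d ∷ Q) e x = trans (eval-head [] x)
  (cong₂ (λ a b → a + x * b) (e 0) (eval-cong [] Q (e ∘ suc) x))
eval-cong (c ∷ P) []      e x = trans
  (cong₂ (λ a b → a + x * b) (e 0) (eval-cong P [] (e ∘ suc) x)) (≡-sym (eval-head [] x))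
eval-cong (c ∷ P) (d ∷ Q) e x =
  cong₂ (λ a b → a + x * b) (e 0) (eval-cong P Q (e ∘ suc) x)

-- A nonzero multiple of |d| + 1 has absolute value above |d|.
∣n∣+1-divides⇒0 : ∀ d r → d ≡ + suc ∣ d ∣ * r → d ≡ + 0
∣n∣+1-divides⇒0 d r eq =
  ℤ.∣i∣≡0⇒i≡0 (small ∣ d ∣ ∣ r ∣ (trans (cong ∣_∣ eq) (ℤ.abs-* (+ suc ∣ d ∣) r)))
  where
  small : ∀ a b → a ≡ suc a ℕ.* b → a ≡ 0
  small a zero    e = trans e (ℕ.*-zeroʳ (suc a))
  small a (suc b) e = contradiction e (ℕ.<⇒≢ (ℕ.m≤m*n (suc a) (suc b)))

-- If c + x r = d + x s for all x ≥ 1 then c - d is divisible by |c - d| + 1, hence zero.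
agree⇒≐ : ∀ P Q → (∀ p → eval P (+ suc p) ≡ eval Q (+ suc p)) → P ≐ Q
agree⇒≐ P Q agree zero = ℤ.i-j≡0⇒i≡j c d (∣n∣+1-divides⇒0 (c - d) (s - r) (begin
    c - d
      ≡⟨ solve 4 (λ c d x r → c :+ :- d := (c :+ x :* r) :+ :- d :+ :- (x :* r)) refl c d x r ⟩
    (c + x * r) - d - x * r
      ≡⟨ cong (λ z → z - d - x * r) (trans (≡-sym (eval-head P x)) (trans (agree _) (eval-head Q x))) ⟩
    (d + x * s) - d - x * r
      ≡⟨ solve 4 (λ d x r s → (d :+ x :* s) :+ :- d :+ :- (x :* r) := x :* (s :+ :- r)) refl d x r s ⟩
    x * (s - r) ∎))
  where
  open ≡-Reasoning
  c d x r s : ℤ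
  c = coeff P 0
  d = coeff Q 0
  x = + suc ∣ c - d ∣
  r = eval (drop 1 P) x
  s = eval (drop 1 Q) x
agree⇒≐ P Q agree (suc i) =
  trans (≡-sym (coeff-drop P i)) (trans (agree⇒≐ (drop 1 P) (drop 1 Q) agree′ i) (coeff-drop Q i))
  where
  agree′ : ∀ p → eval (drop 1 P) (+ suc p) ≡ eval (drop 1 Q) (+ suc p)
  -- The equal constant terms cancel, and the remaining factor p + 1 is nonzero.
  agree′ p = ℤ.*-cancelˡ-≡ (+ suc p) _ _ (∙-cancelˡ (coeff P 0) _ _ (begin
    coeff P 0 + + suc p * eval (drop 1 P) (+ suc p) ≡⟨ eval-head P (+ suc p) ⟨
    eval P (+ suc p)                                ≡⟨ agree p ⟩
    eval Q (+ suc p)                                ≡⟨ eval-head Q (+ suc p) ⟩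
    coeff Q 0 + + suc p * eval (drop 1 Q) (+ suc p) ≡⟨ cong (_+ _) (agree⇒≐ P Q agree zero) ⟨
    coeff P 0 + + suc p * eval (drop 1 Q) (+ suc p) ∎))
    where open ≡-Reasoning

coeff-derivFrom : ∀ k P i → coeff (derivFrom k P) i ≡ + (k ℕ.+ i) * coeff P i
coeff-derivFrom k []      i       = ≡-sym (ℤ.*-zeroʳ (+ (k ℕ.+ i)))
coeff-derivFrom k (c ∷ P) zero    rewrite ℕ.+-identityʳ k = refl
coeff-derivFrom k (c ∷ P) (suc i) rewrite ℕ.+-suc k i = coeff-derivFrom (suc k) P i

coeff-deriv : ∀ P i → coeff (deriv P) i ≡ + suc i * coeff P (suc i)
coeff-deriv []      i = ≡-sym (ℤ.*-zeroʳ (+ suc i))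
coeff-deriv (c ∷ P) i = coeff-derivFrom 1 P i

deriv-cong : ∀ {P Q} → P ≐ Q → deriv P ≐ deriv Q
deriv-cong {P} {Q} e i = trans (coeff-deriv P i)
  (trans (cong (+ suc i *_) (e (suc i))) (≡-sym (coeff-deriv Q i)))

derivN-cong : ∀ m {P Q} → P ≐ Q → derivN m P ≐ derivN m Q
derivN-cong zero    e = e
derivN-cong (suc m) {P} {Q} e = deriv-cong {derivN m P} {derivN m Q} (derivN-cong m e)

derivN-deriv : ∀ m P → derivN (suc m) P ≡ derivN m (deriv P)
derivN-deriv zero    P = refl
derivN-deriv (suc m) P = cong deriv (derivN-deriv m P)

infixl 6 _⊕_
_⊕_ : Poly → Poly → Poly
[]      ⊕ Q       = Q
P       ⊕ []      = P
(c ∷ P) ⊕ (d ∷ Q) = (c + d) ∷ (P ⊕ Q)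

coeff-⊕ : ∀ P Q i → coeff (P ⊕ Q) i ≡ coeff P i + coeff Q i
coeff-⊕ []      Q       i       = ≡-sym (ℤ.+-identityˡ _)
coeff-⊕ (c ∷ P) []      i       = ≡-sym (ℤ.+-identityʳ _)
coeff-⊕ (c ∷ P) (d ∷ Q) zero    = refl
coeff-⊕ (c ∷ P) (d ∷ Q) (suc i) = coeff-⊕ P Q i

eval-⊕ : ∀ P Q x → eval (P ⊕ Q) x ≡ eval P x + eval Q x
eval-⊕ []      Q       x = ≡-sym (ℤ.+-identityˡ _)
eval-⊕ (c ∷ P) []      x = ≡-sym (ℤ.+-identityʳ _)
eval-⊕ (c ∷ P) (d ∷ Q) x = trans (cong (λ z → c + d + x * z) (eval-⊕ P Q x))
  (solve 5 (λ c d x p q → (c :+ d) :+ x :* (p :+ q) := (c :+ x :* p) :+ (d :+ x :* q)) refl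
    c d x (eval P x) (eval Q x))

deriv-⊕ : ∀ P Q → deriv (P ⊕ Q) ≐ deriv P ⊕ deriv Q
deriv-⊕ P Q i = begin
  coeff (deriv (P ⊕ Q)) i                            ≡⟨ coeff-deriv (P ⊕ Q) i ⟩
  + suc i * coeff (P ⊕ Q) (suc i)                     ≡⟨ cong (+ suc i *_) (coeff-⊕ P Q (suc i)) ⟩
  + suc i * (coeff P (suc i) + coeff Q (suc i))
    ≡⟨ ℤ.*-distribˡ-+ (+ suc i) (coeff P (suc i)) (coeff Q (suc i)) ⟩
  + suc i * coeff P (suc i) + + suc i * coeff Q (suc i)
    ≡⟨ cong₂ _+_ (coeff-deriv P i) (coeff-deriv Q i) ⟨
  coeff (deriv P) i + coeff (deriv Q) i              ≡⟨ coeff-⊕ (deriv P) (deriv Q) i ⟨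
  coeff (deriv P ⊕ deriv Q) i                        ∎
  where open ≡-Reasoning

derivN-⊕ : ∀ m P Q → derivN m (P ⊕ Q) ≐ derivN m P ⊕ derivN m Q
derivN-⊕ zero    P Q i = refl
derivN-⊕ (suc m) P Q i = trans
  (deriv-cong {derivN m (P ⊕ Q)} {derivN m P ⊕ derivN m Q} (derivN-⊕ m P Q) i)
  (deriv-⊕ (derivN m P) (derivN m Q) i)

monomial : ℤ → ℕ → Poly
monomial c zero    = c ∷ []
monomial c (suc k) = + 0 ∷ monomial c k

eval-monomial : ∀ c k x → eval (monomial c k) x ≡ c * x ^ k
eval-monomial c zero    x = solve 2 (λ c x → c :+ x :* con (+ 0) := c :* con (+ 1)) refl c x
eval-monomial c (suc k) x = trans (cong (λ z → + 0 + x * z) (eval-monomial c k x))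
  (solve 3 (λ c x y → con (+ 0) :+ x :* (c :* y) := c :* (x :* y)) refl c x (x ^ k))

derivFrom-monomial : ∀ j c k → derivFrom j (monomial c k) ≡ monomial (+ (j ℕ.+ k) * c) k
derivFrom-monomial j c zero    rewrite ℕ.+-identityʳ j = refl
derivFrom-monomial j c (suc k) rewrite ℕ.+-suc j k =
  cong₂ _∷_ (ℤ.*-zeroʳ (+ j)) (derivFrom-monomial (suc j) c k)

-- This is k (k - 1) ⋯ (k - m + 1) x^(k - m), the m-th derivative of q^k at x, and 0 when m exceeds
-- k. The recursion avoids a truncated subtraction in the exponent.
powDeriv : (x : ℤ) (m k : ℕ) → ℤ
powDeriv x zero    k       = x ^ k
powDeriv x (suc m) zero    = + 0
powDeriv x (suc m) (suc k) = + suc k * powDeriv x m k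

derivN-[] : ∀ m → derivN m [] ≡ []
derivN-[] zero    = refl
derivN-[] (suc m) = cong deriv (derivN-[] m)

eval-derivN-monomial : ∀ m c k x → eval (derivN m (monomial c k)) x ≡ c * powDeriv x m k
eval-derivN-monomial zero    c k       x = eval-monomial c k x
eval-derivN-monomial (suc m) c zero    x
  rewrite derivN-deriv m (monomial c 0) | derivN-[] m = ≡-sym (ℤ.*-zeroʳ c)
eval-derivN-monomial (suc m) c (suc k) x
  rewrite derivN-deriv m (monomial c (suc k)) | derivFrom-monomial 1 c k =
  trans (eval-derivN-monomial m (+ suc k * c) k x)
    (solve 3 (λ a c y → (a :* c) :* y := c :* (a :* y)) refl (+ suc k) c (powDeriv x m k))

-- Sums of integers over lists

Σℤ : {A : Set} → (A → ℤ) → List A → ℤ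
Σℤ f []       = + 0
Σℤ f (a ∷ as) = f a + Σℤ f as

Σℤ-++ : {A : Set} (f : A → ℤ) (as bs : List A) → Σℤ f (as ++ bs) ≡ Σℤ f as + Σℤ f bs
Σℤ-++ f []       bs = ≡-sym (ℤ.+-identityˡ _)
Σℤ-++ f (a ∷ as) bs = trans (cong (_+_ (f a)) (Σℤ-++ f as bs)) (≡-sym (ℤ.+-assoc (f a) _ _))

Σℤ-map : {A B : Set} (f : B → ℤ) (g : A → B) (as : List A) → Σℤ f (map g as) ≡ Σℤ (f ∘ g) as
Σℤ-map f g []       = refl
Σℤ-map f g (a ∷ as) = cong (_+_ (f (g a))) (Σℤ-map f g as)

Σℤ-cong : {A : Set} {f g : A → ℤ} (as : List A) → (∀ {a} → a ∈ as → f a ≡ g a) → Σℤ f as ≡ Σℤ g as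
Σℤ-cong []       e = refl
Σℤ-cong (a ∷ as) e = cong₂ _+_ (e (here refl)) (Σℤ-cong as (e ∘ there))

Σℤ-*ˡ : {A : Set} (c : ℤ) (f : A → ℤ) (as : List A) → Σℤ (λ a → c * f a) as ≡ c * Σℤ f as
Σℤ-*ˡ c f []       = ≡-sym (ℤ.*-zeroʳ c)
Σℤ-*ˡ c f (a ∷ as) = trans (cong (_+_ (c * f a)) (Σℤ-*ˡ c f as)) (≡-sym (ℤ.*-distribˡ-+ c _ _))

Σℤ-sum : {A : Set} (f : A → ℕ) (as : List A) → Σℤ (+_ ∘ f) as ≡ + sum (map f as)
Σℤ-sum f []       = refl
Σℤ-sum f (a ∷ as) = cong (_+_ (+ f a)) (Σℤ-sum f as)

fromTerms : {A : Set} → (A → ℤ) → (A → ℕ) → List A → Poly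
fromTerms c k []       = []
fromTerms c k (a ∷ as) = monomial (c a) (k a) ⊕ fromTerms c k as

eval-derivN-fromTerms : {A : Set} (c : A → ℤ) (k : A → ℕ) (as : List A) (m : ℕ) (x : ℤ) →
  eval (derivN m (fromTerms c k as)) x ≡ Σℤ (λ a → c a * powDeriv x m (k a)) as
eval-derivN-fromTerms c k []       m x rewrite derivN-[] m = refl
eval-derivN-fromTerms c k (a ∷ as) m x = begin
  eval (derivN m (M ⊕ R)) x
    ≡⟨ eval-cong (derivN m (M ⊕ R)) (derivN m M ⊕ derivN m R) (derivN-⊕ m M R) x ⟩
  eval (derivN m M ⊕ derivN m R) x         ≡⟨ eval-⊕ (derivN m M) (derivN m R) x ⟩
  eval (derivN m M) x + eval (derivN m R) x
    ≡⟨ cong₂ _+_ (eval-derivN-monomial m (c a) (k a) x) (eval-derivN-fromTerms c k as m x) ⟩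
  Σℤ (λ a → c a * powDeriv x m (k a)) (a ∷ as) ∎
  where
  open ≡-Reasoning
  M R : Poly
  M = monomial (c a) (k a)
  R = fromTerms c k as

-- A chromatic polynomial is known only through its values. Agreement at all positive integers
-- forces equal coefficients, and these determine all derivatives at every point, negative ones
-- included.
eval-derivN-agree : {A : Set} (P : Poly) (c : A → ℤ) (k : A → ℕ) (as : List A) →
  (∀ p → eval P (+ suc p) ≡ Σℤ (λ a → c a * (+ suc p) ^ k a) as) →
  ∀ m x → eval (derivN m P) x ≡ Σℤ (λ a → c a * powDeriv x m (k a)) as
eval-derivN-agree P c k as agree m x = trans
  (eval-cong (derivN m P) (derivN m Q) (derivN-cong m {P} {Q} (agree⇒≐ P Q (λ p →
    trans (agree p) (≡-sym (eval-derivN-fromTerms c k as 0 (+ suc p)))))) x)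
  (eval-derivN-fromTerms c k as m x)
  where
  Q : Poly
  Q = fromTerms c k as

-- Derivatives of powers at negative arguments

powDerivℕ : (l m k : ℕ) → ℕ
powDerivℕ l zero    k       = l ℕ.^ k
powDerivℕ l (suc m) zero    = 0
powDerivℕ l (suc m) (suc k) = suc k ℕ.* powDerivℕ l m k

-1^_ : ℕ → ℤ
-1^ k = -[1+ 0 ] ^ k

-- Each of the k - m remaining factors -l contributes one sign. For k < m the exponent is truncated
-- to 0, which is harmless because both sides vanish.
powDeriv-neg : ∀ l m k → powDeriv (- + l) m k ≡ -1^ (k ℕ.∸ m) * + powDerivℕ l m k
powDeriv-neg l zero    zero    = refl
powDeriv-neg l zero    (suc k) = begin
  - + l * (- + l) ^ k                          ≡⟨ cong (- + l *_) (powDeriv-neg l zero k) ⟩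
  - + l * (-1^ k * + (l ℕ.^ k))
    ≡⟨ solve 3 (λ l s y → :- l :* (s :* y) := (con -[1+ 0 ] :* s) :* (l :* y)) refl
         (+ l) (-1^ k) (+ (l ℕ.^ k)) ⟩
  -1^ (suc k) * (+ l * + (l ℕ.^ k))            ≡⟨ cong (-1^ (suc k) *_) (ℤ.pos-* l (l ℕ.^ k)) ⟨
  -1^ (suc k) * + (l ℕ.* l ℕ.^ k)              ∎
  where open ≡-Reasoning
powDeriv-neg l (suc m) zero    = refl
powDeriv-neg l (suc m) (suc k) = begin
  + suc k * powDeriv (- + l) m k               ≡⟨ cong (+ suc k *_) (powDeriv-neg l m k) ⟩
  + suc k * (-1^ (k ℕ.∸ m) * + d)
    ≡⟨ solve 3 (λ a s y → a :* (s :* y) := s :* (a :* y)) refl (+ suc k) (-1^ (k ℕ.∸ m)) (+ d) ⟩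
  -1^ (k ℕ.∸ m) * (+ suc k * + d)              ≡⟨ cong (-1^ (k ℕ.∸ m) *_) (ℤ.pos-* (suc k) d) ⟨
  -1^ (k ℕ.∸ m) * + (suc k ℕ.* d)              ∎
  where
  open ≡-Reasoning
  d = powDerivℕ l m k

-1^-+ : ∀ a b → -1^ (a ℕ.+ b) ≡ -1^ a * -1^ b
-1^-+ = ℤ.^-distribˡ-+-* -[1+ 0 ]

-1^-square : ∀ a → -1^ a * -1^ a ≡ + 1
-1^-square zero    = refl
-1^-square (suc a) = trans
  (solve 1 (λ s → (con -[1+ 0 ] :* s) :* (con -[1+ 0 ] :* s) := s :* s) refl (-1^ a)) (-1^-square a)

powDerivℕ-vanishes : ∀ l {m k} → k ℕ.< m → powDerivℕ l m k ≡ 0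
powDerivℕ-vanishes l {suc m} {zero}  _           = refl
powDerivℕ-vanishes l {suc m} {suc k} (ℕ.s≤s k<m) =
  trans (cong (suc k ℕ.*_) (powDerivℕ-vanishes l k<m)) (ℕ.*-zeroʳ (suc k))

-- For m ≤ k the exponents n - k and k - m add up to n - m, so the total sign is a square. For k < m
-- both sides vanish.
signs-cancel : ∀ l n m k → k ≤ n →
  -1^ (n ℕ.∸ m) * (-1^ (n ℕ.∸ k) * powDeriv (- + l) m k) ≡ + powDerivℕ l m k
signs-cancel l n m k k≤n rewrite powDeriv-neg l m k with m ℕ.≤? k
... | yes m≤k = begin
  -1^ (n ℕ.∸ m) * (-1^ (n ℕ.∸ k) * (-1^ (k ℕ.∸ m) * d))
    ≡⟨ solve 4 (λ a b c d → a :* (b :* (c :* d)) := (a :* (b :* c)) :* d) refl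
         (-1^ (n ℕ.∸ m)) (-1^ (n ℕ.∸ k)) (-1^ (k ℕ.∸ m)) d ⟩
  (-1^ (n ℕ.∸ m) * (-1^ (n ℕ.∸ k) * -1^ (k ℕ.∸ m))) * d
    ≡⟨ cong (λ z → -1^ (n ℕ.∸ m) * z * d) (-1^-+ (n ℕ.∸ k) (k ℕ.∸ m)) ⟨
  (-1^ (n ℕ.∸ m) * -1^ (n ℕ.∸ k ℕ.+ (k ℕ.∸ m))) * d
    ≡⟨ cong (λ z → -1^ (n ℕ.∸ m) * -1^ z * d) telescope ⟩
  (-1^ (n ℕ.∸ m) * -1^ (n ℕ.∸ m)) * d
    ≡⟨ cong (_* d) (-1^-square (n ℕ.∸ m)) ⟩
  + 1 * d
    ≡⟨ ℤ.*-identityˡ d ⟩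
  d ∎
  where
  open ≡-Reasoning
  d = + powDerivℕ l m k
  telescope : n ℕ.∸ k ℕ.+ (k ℕ.∸ m) ≡ n ℕ.∸ m
  telescope = trans (≡-sym (ℕ.+-∸-assoc (n ℕ.∸ k) m≤k)) (cong (ℕ._∸ m) (ℕ.m∸n+n≡m k≤n))
... | no m≰k rewrite powDerivℕ-vanishes l (ℕ.≰⇒> m≰k) | ℤ.*-zeroʳ (-1^ (k ℕ.∸ m))
  | ℤ.*-zeroʳ (-1^ (n ℕ.∸ k)) = ℤ.*-zeroʳ (-1^ (n ℕ.∸ m))

module _ {n : ℕ} (G : Graph n) where

  private
    V W : Set
    V = Fin n
    W = List V

  _∈?_ : (a : V) (w : W) → Dec (a ∈ w)
  _∈?_ = member? Fin._≟_

  -- Heaps as words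

  infix 4 _≃_ _⊑_ _≈_
  _≃_ : W → W → Set
  u ≃ v = _~_ G u v

  Adj : V → V → Set
  Adj a b = T (adj G a b)

  Adj-sym : ∀ {a b} → Adj a b → Adj b a
  Adj-sym {a} {b} = subst T (Graph.sym G a b)

  Adj-irrefl : ∀ {a} → ¬ Adj a a
  Adj-irrefl {a} = subst T (Graph.irrefl G a)

  Adj? : ∀ a b → Dec (Adj a b)
  Adj? a b = T? (adj G a b)

  -- On words without repeated letters u ≈ v says that u and v represent the same heap: a heap is
  -- determined by its vertices and by the relative order of adjacent ones.
  record _⊑_ (u v : W) : Set where
    constructor _,_
    field
      letters : ∀ {a} → a ∈ u → a ∈ v
      order   : ∀ {a b} → Adj a b → Bef u a b → Bef v a b
  open _⊑_

  _≈_ : W → W → Set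
  u ≈ v = (u ⊑ v) × (v ⊑ u)

  ≈-refl : ∀ {u} → u ≈ u
  ≈-refl = ((λ i → i) , (λ _ p → p)) , ((λ i → i) , (λ _ p → p))

  ≈-sym : ∀ {u v} → u ≈ v → v ≈ u
  ≈-sym (p , q) = q , p

  ⊑-trans : ∀ {u v w} → u ⊑ v → v ⊑ w → u ⊑ w
  ⊑-trans (f , g) (h , k) = (h ∘ f) , (λ e → k e ∘ g e)

  ≈-trans : ∀ {u v w} → u ≈ v → v ≈ w → u ≈ w
  ≈-trans (p , q) (r , s) = ⊑-trans p r , ⊑-trans s q

  ⊑-++ : ∀ {u u′ v v′} → u ⊑ u′ → v ⊑ v′ → u ++ v ⊑ u′ ++ v′
  ⊑-++ {u} {u′} (f , g) (h , k) =
    ([ ∈-++⁺ˡ ∘ f , ∈-++⁺ʳ u′ ∘ h ]′ ∘ ∈-++⁻ u) ,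
    (λ e → [ bef-++ˡ ∘ g e , [ (λ (i , j) → bef-across (f i) (h j)) , bef-++ʳ u′ ∘ k e ]′ ]′ ∘ bef-++⁻ u)

  ≈-++ : ∀ {u u′ v v′} → u ≈ u′ → v ≈ v′ → u ++ v ≈ u′ ++ v′
  ≈-++ (p , q) (r , s) = ⊑-++ p r , ⊑-++ q s

  -- No letter is repeated and the right parts have the same letters, so a letter alone decides in
  -- which part of the product it lies, and the orders can be compared part by part.
  ⊑-cancel : ∀ u u′ {v v′} → Unique (u ++ v) → Unique (u′ ++ v′) → u ++ v ⊑ u′ ++ v′ →
             (∀ {a} → a ∈ v → a ∈ v′) → (∀ {a} → a ∈ v′ → a ∈ v) → u ⊑ u′ × v ⊑ v′
  ⊑-cancel u u′ {v} {v′} U U′ (f , g) v⊆v′ v′⊆v =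
    (u⊆u′ , ordˡ) , (v⊆v′ , ordʳ)
    where
    u⊆u′ : ∀ {a} → a ∈ u → a ∈ u′
    u⊆u′ i with ∈-++⁻ u′ (f (∈-++⁺ˡ i))
    ... | inj₁ j = j
    ... | inj₂ j = contradiction (v′⊆v j) (Unique-disjoint u U i)
    ordˡ : ∀ {a b} → Adj a b → Bef u a b → Bef u′ a b
    ordˡ e p with bef-++⁻ u′ (g e (bef-++ˡ p))
    ... | inj₁ q              = q
    ... | inj₂ (inj₁ (_ , j)) = contradiction j (Unique-disjoint u′ U′ (u⊆u′ (bef-∈ʳ p)))
    ... | inj₂ (inj₂ q)       = contradiction (bef-∈ʳ q) (Unique-disjoint u′ U′ (u⊆u′ (bef-∈ʳ p)))
    ordʳ : ∀ {a b} → Adj a b → Bef v a b → Bef v′ a b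
    ordʳ e p with bef-++⁻ u′ (g e (bef-++ʳ u p))
    ... | inj₁ q              = contradiction (v⊆v′ (bef-∈ˡ p)) (Unique-disjoint u′ U′ (bef-∈ˡ q))
    ... | inj₂ (inj₁ (i , _)) = contradiction (v⊆v′ (bef-∈ˡ p)) (Unique-disjoint u′ U′ i)
    ... | inj₂ (inj₂ q)       = q

  ≈-cancel : ∀ u u′ {v v′} → Unique (u ++ v) → Unique (u′ ++ v′) → u ++ v ≈ u′ ++ v′ →
             (∀ {a} → a ∈ v → a ∈ v′) → (∀ {a} → a ∈ v′ → a ∈ v) → u ≈ u′ × v ≈ v′
  ≈-cancel u u′ U U′ (p , q) f g =
    let (r , s) = ⊑-cancel u u′ U U′ p f g
        (t , z) = ⊑-cancel u′ u U′ U q g f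
    in (r , t) , (s , z)

  ≈-∷⁻ : ∀ {a u v} → Unique (a ∷ u) → Unique (a ∷ v) → a ∷ u ≈ a ∷ v → u ≈ v
  ≈-∷⁻ {a} U U′ (p , q) = proj₂ (≈-cancel (a ∷ []) (a ∷ []) U U′ (p , q) (sub U p) (sub U′ q))
    where
    sub : ∀ {u v} → Unique (a ∷ u) → a ∷ u ⊑ a ∷ v → ∀ {b} → b ∈ u → b ∈ v
    sub U p i with letters p (there i)
    ... | here refl = contradiction i (Unique-head U)
    ... | there j   = j

  ⊑-commute : ∀ {u v} → (∀ {a b} → a ∈ u → b ∈ v → ¬ Adj a b) → u ++ v ⊑ v ++ u
  ⊑-commute {u} {v} ¬adj =
    ([ ∈-++⁺ʳ v , ∈-++⁺ˡ ]′ ∘ ∈-++⁻ u) ,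
    (λ e → [ bef-++ʳ v , [ (λ (i , j) → contradiction e (¬adj i j)) , bef-++ˡ ]′ ]′ ∘ bef-++⁻ u)

  ≈-commute : ∀ {u v} → (∀ {a b} → a ∈ u → b ∈ v → ¬ Adj a b) → u ++ v ≈ v ++ u
  ≈-commute ¬adj = ⊑-commute ¬adj , ⊑-commute (λ i j → ¬adj j i ∘ Adj-sym)

  ≈⇒↭ : ∀ {u v} → Unique u → Unique v → u ≈ v → u ↭ v
  ≈⇒↭ U U′ (p , q) = unique-set⇒↭ U U′ (letters p) (letters q)

  ≃⇒↭ : ∀ {u v} → u ≃ v → u ↭ v
  ≃⇒↭ ε = ↭.refl
  ≃⇒↭ (fwd (swap u v a b _) ◅ s) = ↭-trans (++⁺ˡ u (↭.swap a b ↭.refl)) (≃⇒↭ s)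
  ≃⇒↭ (bwd (swap u v a b _) ◅ s) = ↭-trans (++⁺ˡ u (↭.swap b a ↭.refl)) (≃⇒↭ s)

  ≃-sym : ∀ {u v} → u ≃ v → v ≃ u
  ≃-sym = EqClosure.symmetric (Swap G)

  ¬Adj-false : ∀ {a b} → adj G a b ≡ false → ¬ Adj a b
  ¬Adj-false = subst T

  swap-≈ : ∀ {u v} → Swap G u v → u ≈ v
  swap-≈ (swap u v a b (_ , e)) =
    ≈-++ {u} ≈-refl (≈-++ {a ∷ b ∷ []}
      (≈-commute {a ∷ []} {b ∷ []} λ { (here refl) (here refl) → ¬Adj-false e }) ≈-refl)

  ≃⇒≈ : ∀ {u v} → u ≃ v → u ≈ v
  ≃⇒≈ ε           = ≈-refl
  ≃⇒≈ (fwd s ◅ r) = ≈-trans (swap-≈ s) (≃⇒≈ r)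
  ≃⇒≈ (bwd s ◅ r) = ≈-trans (≈-sym (swap-≈ s)) (≃⇒≈ r)

  ¬Adj⇒false : ∀ {a b} → ¬ Adj a b → adj G a b ≡ false
  ¬Adj⇒false {a} {b} ¬e with adj G a b
  ... | true  = contradiction tt ¬e
  ... | false = refl

  -- Minimal pieces of a heap

  ≃-∷ : ∀ a {u v} → u ≃ v → a ∷ u ≃ a ∷ v
  ≃-∷ a = EqClosure.gmap (a ∷_) λ { (swap u v b c e) → swap (a ∷ u) v b c e }

  ≃-to-front : ∀ p {a r} → (∀ {c} → c ∈ p → c ≢ a × ¬ Adj c a) → p ++ a ∷ r ≃ a ∷ p ++ r
  ≃-to-front []      f = ε
  ≃-to-front (c ∷ p) {a} f =
    ≃-∷ c (≃-to-front p (f ∘ there)) ◅◅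
    (fwd (swap [] _ c a (proj₁ (f (here refl)) , ¬Adj⇒false (proj₂ (f (here refl))))) ◅ ε)

  -- `Src a w` says that `a` is a minimal piece of the heap of `w`, that is, a source of the
  -- corresponding acyclic orientation.
  Src : V → W → Set
  Src a w = a ∈ w × (∀ {b} → Adj b a → ¬ Bef w b a)

  Src-resp : ∀ {a u v} → u ≈ v → Src a u → Src a v
  Src-resp (p , q) (i , f) = letters p i , (λ e → f e ∘ order q e)

  Src-here : ∀ {a w} → Unique (a ∷ w) → Src a (a ∷ w)
  Src-here U = here refl ,
    λ { e (here i) → Unique-head U i ; e (there p) → Unique-head U (bef-∈ʳ p) }

  Src-there : ∀ {a b w} → ¬ Adj b a → Src a w → Src a (b ∷ w)
  Src-there ¬e (i , f) = there i , λ { e (here _) → ¬e e ; e (there p) → f e p }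

  Src-∷⁻ : ∀ {a b w} → Src a (b ∷ w) → a ≡ b ⊎ (¬ Adj b a × Src a w)
  Src-∷⁻ (here refl , f) = inj₁ refl
  Src-∷⁻ (there i   , f) = inj₂ ((λ e → f e (here i)) , i , (λ e → f e ∘ there))

  Src-split : ∀ {a w} → Unique w → Src a w → ∃ λ u → w ≃ a ∷ u × Unique (a ∷ u)
  Src-split {a} U (i , f) with ∈-∃++ i
  ... | p , r , refl = p ++ r , ≃-to-front p precedes , Unique-shift p U
    where
    precedes : ∀ {c} → c ∈ p → c ≢ a × ¬ Adj c a
    precedes j = (λ { refl → Unique-disjoint p U j (here refl) }) ,
               (λ e → f e (bef-across j (here refl)))

  -- The first letter of `u` is a minimal piece of the heap, hence also of `v`. Commuting it to the
  -- front of `v` and cancelling it leaves shorter words.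
  ≈⇒≃ : ∀ {u v} → Unique u → Unique v → u ≈ v → u ≃ v
  ≈⇒≃ {[]}    {[]}    U U′ e = ε
  ≈⇒≃ {[]}    {a ∷ v} U U′ e with letters (proj₂ e) (here refl)
  ... | ()
  ≈⇒≃ {a ∷ u} {v} U@(_ ∷ U₁) U′ e
    with v′ , v≃ , U″ ← Src-split U′ (Src-resp e (Src-here U)) =
    ≃-∷ a (≈⇒≃ U₁ (AllPairs.tail U″) (≈-∷⁻ U U″ (≈-trans e (≃⇒≈ v≃)))) ◅◅ ≃-sym v≃
  Unique-≃ : ∀ {u v} → Unique u → v ≃ u → Unique v
  Unique-≃ U e = Unique-↭ (↭-sym (≃⇒↭ e)) U

  -- Induction upwards in the heap. When the first letter `c` is removed, a minimal piece of the
  -- rest either was minimal before or is adjacent to `c`; in the second case `M` passes to it from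
  -- `c`.
  Src-propagate : ∀ {M : V → Set} {t} → Unique t → (∀ {a} → Src a t → M a) →
                  (∀ {a b} → Adj a b → Bef t a b → M a → M b) → ∀ {b} → b ∈ t → M b
  Src-propagate U       src step (here refl) = src (Src-here U)
  Src-propagate {M} {c ∷ t} U@(_ ∷ U₁) src step (there i) =
    Src-propagate U₁ src′ (λ e p → step e (there p)) i
    where
    src′ : ∀ {a} → Src a t → M a
    src′ {a} s with Adj? c a
    ... | yes e = step e (here (proj₁ s)) (src (Src-here U))
    ... | no ¬e = src (Src-there ¬e s)

  -- Lyndon heaps are pyramids

  Pyramid : V → W → Set
  Pyramid x w = ∀ {a} → Src a w → a ≡ x

  Pyramid-tail : ∀ {x t} → Unique (x ∷ t) → Pyramid x (x ∷ t) → ∀ {a} → Src a t → Adj x a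
  Pyramid-tail {x} U pyr {a} s with Adj? x a
  ... | yes e = e
  ... | no ¬e = contradiction (subst (_∈ _) (pyr (Src-there ¬e s)) (proj₁ s)) (Unique-head U)

  Pyramid-∷ : ∀ {x t} → (∀ {a} → Src a t → Adj x a) → Pyramid x (x ∷ t)
  Pyramid-∷ adj s with Src-∷⁻ s
  ... | inj₁ eq        = eq
  ... | inj₂ (¬e , s′) = contradiction (adj s′) ¬e

  -- Requiring the word to begin with `x` loses nothing: every word of a nonempty pyramid begins
  -- with its only minimal piece.
  data MinPyramid : W → Set where
    minPyr : ∀ {x t} → (∀ {a} → a ∈ t → x Fin.≤ a) → Pyramid x (x ∷ t) → MinPyramid (x ∷ t)

  -- X a counts how often the vertex a is moved from the bottom to the top of the heap between w and w′.
  Drift : (V → ℕ) → W → W → Set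
  Drift X w w′ = ∀ {a b} → Adj a b → Bef w a b →
    (Bef w′ a b × X a ≡ X b) ⊎ (Bef w′ b a × X a ≡ suc (X b))

  -- An edge is reversed when its lower end is moved once more than its upper end. Two reversals
  -- restore the direction, and both ends have then been moved equally often.
  Drift-trans : ∀ {X Y u v w} → Drift X u v → Drift Y v w → Drift (λ a → X a ℕ.+ Y a) u w
  Drift-trans {X} {Y} d d′ {a} {b} e p with d e p
  ... | inj₁ (q , x≡) with d′ e q
  ...   | inj₁ (r , y≡) = inj₁ (r , cong₂ ℕ._+_ x≡ y≡)
  ...   | inj₂ (r , y≡) = inj₂ (r , trans (cong₂ ℕ._+_ x≡ y≡) (ℕ.+-suc (X b) (Y b)))
  Drift-trans {X} {Y} d d′ {a} {b} e p | inj₂ (q , x≡) with d′ (Adj-sym e) q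
  ...   | inj₁ (r , y≡) = inj₂ (r , cong₂ ℕ._+_ x≡ (≡-sym y≡))
  ...   | inj₂ (r , y≡) = inj₁ (r , trans (cong (ℕ._+ Y a) x≡)
                                      (trans (≡-sym (ℕ.+-suc (X b) (Y a))) (cong (X b ℕ.+_) (≡-sym y≡))))

  indicator : W → V → ℕ
  indicator u a with a ∈? u
  ... | yes _ = 1
  ... | no _  = 0

  indicator-∈ : ∀ {u a} → a ∈ u → indicator u a ≡ 1
  indicator-∈ {u} {a} i with a ∈? u
  ... | yes _ = refl
  ... | no ¬i = contradiction i ¬i

  indicator-∉ : ∀ {u a} → a ∉ u → indicator u a ≡ 0
  indicator-∉ {u} {a} ¬i with a ∈? u
  ... | yes i = contradiction i ¬i
  ... | no _  = refl

  -- The pieces of `u` pass once from the bottom to the top, so the counter is the indicator of `u`;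
  -- only edges from `u` to `v` change direction.
  Conj₁-drift : ∀ {w w′} → Unique w → Conj₁ G w w′ → w ↭ w′ × ∃ λ X → Drift X w w′
  Conj₁-drift {w} {w′} U (u , v , w≃ , w′≃) =
    ↭-trans (≃⇒↭ w≃) (↭-trans (++-comm u v) (↭-sym (≃⇒↭ w′≃))) , indicator u , drift
    where
    U′ : Unique (u ++ v)
    U′ = Unique-↭ (≃⇒↭ w≃) U
    ∉u : ∀ {a} → a ∈ v → indicator u a ≡ 0
    ∉u j = indicator-∉ (λ i → Unique-disjoint u U′ i j)
    back : ∀ {a b} → Adj a b → Bef (v ++ u) a b → Bef w′ a b
    back e = order (proj₂ (≃⇒≈ w′≃)) e
    drift : Drift (indicator u) w w′
    drift e p with bef-++⁻ u (order (proj₁ (≃⇒≈ w≃)) e p)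
    ... | inj₁ q = inj₁ (back e (bef-++ʳ v q) ,
                         trans (indicator-∈ (bef-∈ˡ q)) (≡-sym (indicator-∈ (bef-∈ʳ q))))
    ... | inj₂ (inj₁ (i , j)) = inj₂ (back (Adj-sym e) (bef-across j i) ,
                                      trans (indicator-∈ i) (cong suc (≡-sym (∉u j))))
    ... | inj₂ (inj₂ q) = inj₁ (back e (bef-++ˡ q) , trans (∉u (bef-∈ˡ q)) (≡-sym (∉u (bef-∈ʳ q))))

  Conj-drift : ∀ {w w′} → Unique w → Conj G w w′ → w ↭ w′ × ∃ λ X → Drift X w w′
  Conj-drift U ε        = ↭-refl , (λ _ → 0) , (λ e p → inj₁ (p , refl))
  Conj-drift U (c ◅ cs) =
    let (p , X , d)  = Conj₁-drift U c
        (q , Y , d′) = Conj-drift (Unique-↭ p U) cs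
    in ↭-trans p q , _ , Drift-trans d d′

  -- Going up in `w` the counter never increases, and going up in `w′` it never decreases. Both
  -- heaps start at `x`, so the counter is constantly `X x` and no edge has been reversed.
  Conj-pyramids⇒≈ : ∀ {x w w′} → Unique w → Pyramid x w → Pyramid x w′ → Conj G w w′ → w ≈ w′
  Conj-pyramids⇒≈ {x} {w} {w′} U pyr pyr′ c with Conj-drift U c
  ... | w↭w′ , X , drift = (∈-resp-↭ w↭w′ , fwd-order) , (∈-resp-↭ (↭-sym w↭w′) , bwd-order)
    where
    U′ : Unique w′
    U′ = Unique-↭ w↭w′ U
    upper : ∀ {b} → b ∈ w → X b ℕ.≤ X x
    upper = Src-propagate U (λ s → ℕ.≤-reflexive (cong X (pyr s))) step
      where
      step : ∀ {a b} → Adj a b → Bef w a b → X a ℕ.≤ X x → X b ℕ.≤ X x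
      step e p le with drift e p
      ... | inj₁ (_ , eq) = subst (ℕ._≤ X x) eq le
      ... | inj₂ (_ , eq) = ℕ.<⇒≤ (subst (ℕ._≤ X x) eq le)
    lower : ∀ {b} → b ∈ w′ → X x ℕ.≤ X b
    lower = Src-propagate U′ (λ s → ℕ.≤-reflexive (cong X (≡-sym (pyr′ s)))) step
      where
      ∈w : ∀ {a} → a ∈ w′ → a ∈ w
      ∈w = ∈-resp-↭ (↭-sym w↭w′)
      step : ∀ {a b} → Adj a b → Bef w′ a b → X x ℕ.≤ X a → X x ℕ.≤ X b
      step {a} {b} e p le with bef-total (∈w (bef-∈ˡ p)) (∈w (bef-∈ʳ p)) (λ { refl → Adj-irrefl e })
      ... | inj₁ q with drift e q
      ...   | inj₁ (_ , eq) = subst (X x ℕ.≤_) eq le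
      ...   | inj₂ (r , _)  = contradiction p (bef-asym U′ r)
      step {a} {b} e p le | inj₂ q with drift (Adj-sym e) q
      ...   | inj₁ (r , _)  = contradiction p (bef-asym U′ r)
      ...   | inj₂ (_ , eq) = subst (X x ℕ.≤_) (≡-sym eq) (ℕ.m≤n⇒m≤1+n le)
    fwd-order : ∀ {a b} → Adj a b → Bef w a b → Bef w′ a b
    fwd-order e p with drift e p
    ... | inj₁ (q , _)  = q
    ... | inj₂ (q , eq) = contradiction
      (ℕ.≤-trans (upper (bef-∈ˡ p)) (lower (bef-∈ˡ q))) (ℕ.<⇒≱ (ℕ.≤-reflexive (≡-sym eq)))
    bwd-order : ∀ {a b} → Adj a b → Bef w′ a b → Bef w a b
    bwd-order e p with bef-total (∈-resp-↭ (↭-sym w↭w′) (bef-∈ˡ p)) (∈-resp-↭ (↭-sym w↭w′) (bef-∈ʳ p))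
                                 (λ { refl → Adj-irrefl e })
    ... | inj₁ q = q
    ... | inj₂ q = contradiction p (bef-asym U′ (fwd-order (Adj-sym e) q))

  -- Largest words of heaps

  Src? : ∀ a {w} → Unique w → Dec (Src a w)
  Src? a {[]}    U = no λ ()
  Src? a {b ∷ w} U@(_ ∷ U₁) with a Fin.≟ b
  ... | yes refl = yes (Src-here U)
  ... | no a≢b with Adj? b a | Src? a U₁
  ...   | no ¬e | yes s = yes (Src-there ¬e s)
  ...   | yes e | _     = no ([ a≢b , (λ (¬e , _) → ¬e e) ]′ ∘ Src-∷⁻)
  ...   | no _  | no ¬s = no ([ a≢b , (λ (_ , s) → ¬s s) ]′ ∘ Src-∷⁻)

  -- Greedy choice: the first letters of the words of a heap are its minimal pieces, so the largest
  -- word begins with the greatest of them and continues with the largest word of the rest.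
  IsSt-exists : ∀ k w → length w ≡ k → Unique w → ∃ (IsSt G w)
  IsSt-exists zero    []      refl U = [] , ε ,
    λ s′ e → subst (λ z → _≤lex_ G z []) (≡-sym (↭-empty-inv (≃⇒↭ e))) []≤
  IsSt-exists (suc k) w@(c ∷ _) l U with greatest (λ a → Src? a U) w
  ... | inj₁ none = contradiction (Src-here U) (none (here refl))
  ... | inj₂ (a , src , top) with Src-split U src
  ... | u , w≃ , U′ with IsSt-exists k u
    (ℕ.suc-injective (trans (≡-sym (↭-length (≃⇒↭ w≃))) l)) (AllPairs.tail U′)
  ... | s , s≃ , max = a ∷ s , (≃-∷ a s≃ ◅◅ ≃-sym w≃) , max′
    where
    max′ : ∀ s′ → s′ ≃ w → _≤lex_ G s′ (a ∷ s)
    max′ []       e = []≤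
    max′ (b ∷ s′) e with Fin.<-cmp b a
    ... | tri< b<a _ _ = head< b<a
    ... | tri> _ _ a<b = contradiction (top (proj₁ src-b) src-b) (ℕ.<⇒≱ a<b)
      where
      src-b : Src b w
      src-b = Src-resp (≃⇒≈ e) (Src-here (Unique-≃ U e))
    ... | tri≈ _ refl _ = head≡ (max s′ (≈⇒≃ (AllPairs.tail U″) (AllPairs.tail U′)
                                  (≈-∷⁻ U″ U′ (≈-trans (≃⇒≈ e) (≃⇒≈ w≃)))))
      where
      U″ : Unique (a ∷ s′)
      U″ = Unique-≃ U e

  st : ∀ {w} → Unique w → ∃ (IsSt G w)
  st {w} = IsSt-exists (length w) w refl

  IsSt-head : ∀ {w b s} → Unique w → IsSt G w (b ∷ s) → Src b w
  IsSt-head U (e , _) = Src-resp (≃⇒≈ e) (Src-here (Unique-≃ U e))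

  ≤lex-head : ∀ {a b u v} → _≤lex_ G (a ∷ u) (b ∷ v) → a Fin.≤ b
  ≤lex-head (head< a<b) = ℕ.<⇒≤ a<b
  ≤lex-head (head≡ _)   = Fin.≤-refl

  Src≤head : ∀ {w a b s} → Unique w → IsSt G w (b ∷ s) → Src a w → a Fin.≤ b
  Src≤head U (_ , max) src = let (u , w≃ , _) = Src-split U src in ≤lex-head (max _ (≃-sym w≃))

  IsSt-nonempty : ∀ {w s} → w ≢ [] → IsSt G w s → ∃₂ λ b s′ → s ≡ b ∷ s′
  IsSt-nonempty {s = []}    w≢[] (e , _) = contradiction (↭-empty-inv (↭-sym (≃⇒↭ e))) w≢[]
  IsSt-nonempty {s = b ∷ s} w≢[] _       = b , s , refl

  -- Primitivity: two nonempty factors `u` and `v` would both begin with `x`, which occurs only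
  -- once. Minimality: the largest word begins with the least vertex `x`; a conjugate whose largest
  -- word also begins with `x` has no other minimal piece, so it is a pyramid over `x` and equals
  -- the given heap.
  MinPyramid⇒Lyndon : ∀ {g} → Unique g → MinPyramid g → Lyndon G g
  MinPyramid⇒Lyndon U (minPyr {x} {t} low pyr) = (λ ()) , prim , minimal
    where
    head-src : ∀ {c u} → x ∷ t ≃ c ∷ u → c ≡ x
    head-src e = pyr (Src-resp (≈-sym (≃⇒≈ e)) (Src-here (Unique-↭ (≃⇒↭ e) U)))
    prim : Primitive G (x ∷ t)
    prim []      v       _ _ = inj₁ refl
    prim (c ∷ u) []      _ _ = inj₂ refl
    prim (c ∷ u) (d ∷ v) e f with head-src e | head-src f
    ... | refl | refl = contradiction (∈-++⁺ʳ u (here refl)) (Unique-head (Unique-↭ (≃⇒↭ e) U))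
    low′ : ∀ {w′ a} → Conj G (x ∷ t) w′ → a ∈ w′ → x Fin.≤ a
    low′ conj i with ∈-resp-↭ (↭-sym (proj₁ (Conj-drift U conj))) i
    ... | here refl = Fin.≤-refl
    ... | there j   = low j
    minimal : ∀ w′ → Conj G (x ∷ t) w′ → _≤H_ G (x ∷ t) w′
    minimal w′ conj su sv isu isv with IsSt-nonempty (λ ()) isu | IsSt-nonempty w′≢[] isv
      where
      w′≢[] : w′ ≢ []
      w′≢[] refl with ∈-resp-↭ (proj₁ (Conj-drift U conj)) (here refl)
      ... | ()
    ... | b , s , refl | c , s′ , refl with pyr (IsSt-head U isu) | Fin.<-cmp b c
    ... | refl | tri< b<c _ _ = head< b<c
    ... | refl | tri> _ _ c<b =
      contradiction (low′ conj (proj₁ (IsSt-head (Unique-↭ (proj₁ (Conj-drift U conj)) U) isv))) (ℕ.<⇒≱ c<b)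
    ... | refl | tri≈ _ refl _ =
      proj₂ isv (b ∷ s) (proj₁ isu ◅◅ ≈⇒≃ U U′ (Conj-pyramids⇒≈ U pyr pyr′ conj))
      where
      U′ : Unique w′
      U′ = Unique-↭ (proj₁ (Conj-drift U conj)) U
      pyr′ : Pyramid b w′
      pyr′ src = Fin.≤-antisym (Src≤head U′ isv src) (low′ conj (proj₁ src))

  -- `v₂` is the up-set generated by the pieces satisfying `Q`, and `v₁` is what remains below.
  split : ∀ {Q : V → Set} → Decidable Q → ∀ {v} → Unique v →
          ∃₂ λ v₁ v₂ → v ≈ v₁ ++ v₂ × Unique (v₁ ++ v₂) × (∀ {a} → a ∈ v₁ → ¬ Q a) × (∀ {a} → Src a v₂ → Q a)
  split Q? {[]}    U = [] , [] , ≈-refl , [] , (λ ()) , (λ ())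
  split {Q} Q? {c ∷ v} U@(n ∷ U₁) with Q? c
  ... | no ¬q with split Q? U₁
  ...   | v₁ , v₂ , e , U₂ , out , inn =
    c ∷ v₁ , v₂ , ≈-++ {c ∷ []} ≈-refl e ,
    Unique-↭ (prep c (≈⇒↭ U₁ U₂ e)) U ,
    (λ { (here refl) → ¬q ; (there i) → out i }) , inn
  split {Q} Q? {c ∷ v} U@(n ∷ U₁) | yes q with split (λ a → Q? a ⊎-dec Adj? c a) U₁
  ...   | v₁ , v₂ , e , U₂ , out , inn =
    v₁ , c ∷ v₂ ,
    ≈-trans (≈-++ {c ∷ []} ≈-refl e)
      (≃⇒≈ (≃-sym (≃-to-front v₁ commutes))) ,
    Unique-↭ (↭-trans (prep c (≈⇒↭ U₁ U₂ e)) (↭-sym (shift c v₁ v₂))) U ,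
    (λ i → out i ∘ inj₁) , inn′
    where
    commutes : ∀ {a} → a ∈ v₁ → a ≢ c × ¬ Adj a c
    commutes i = (λ { refl → Unique-head U (letters (proj₂ e) (∈-++⁺ˡ i)) }) , (λ a → out i (inj₂ (Adj-sym a)))
    inn′ : ∀ {a} → Src a (c ∷ v₂) → Q a
    inn′ s with Src-∷⁻ s
    ... | inj₁ refl = q
    ... | inj₂ (¬e , s′) with inn s′
    ...   | inj₁ q′ = q′
    ...   | inj₂ e′ = contradiction e′ ¬e

  Connected : W → Set
  Connected g = ∀ u v → u ++ v ↭ g → (∀ {a b} → a ∈ u → b ∈ v → ¬ Adj a b) → u ≡ [] ⊎ v ≡ []

  -- If no edge joins `u` and `v`, cutting `g` into the up-set generated by the letters of `u` and
  -- the rest separates exactly the letters of `u` from those of `v`. The two parts commute, so `g`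
  -- is their product in both orders and primitivity makes one of them empty.
  Primitive⇒Connected : ∀ {g} → Unique g → Primitive G g → Connected g
  Primitive⇒Connected {g} U prim u v perm ¬adj with split (_∈? u) U
  ... | v₁ , v₂ , e , U₂ , out , inn = conclude (prim v₁ v₂ (≈⇒≃ U U₂ e)
          (≈⇒≃ U (Unique-↭ (++-comm v₁ v₂) U₂) (≈-trans e (≈-commute apart))))
    where
    Uuv : Unique (u ++ v)
    Uuv = Unique-↭ (↭-sym perm) U
    v₂⊆u : ∀ {a} → a ∈ v₂ → a ∈ u
    v₂⊆u = Src-propagate (Unique-++⁻ʳ v₁ U₂) inn step
      where
      step : ∀ {a b} → Adj a b → Bef v₂ a b → a ∈ u → b ∈ u
      step e′ p i with ∈-++⁻ u (∈-resp-↭ (↭-sym perm) (letters (proj₂ e) (∈-++⁺ʳ v₁ (bef-∈ʳ p))))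
      ... | inj₁ j = j
      ... | inj₂ j = contradiction e′ (¬adj i j)
    v₁⊆v : ∀ {a} → a ∈ v₁ → a ∈ v
    v₁⊆v i with ∈-++⁻ u (∈-resp-↭ (↭-sym perm) (letters (proj₂ e) (∈-++⁺ˡ i)))
    ... | inj₁ j = contradiction j (out i)
    ... | inj₂ j = j
    apart : ∀ {a b} → a ∈ v₁ → b ∈ v₂ → ¬ Adj a b
    apart i j = ¬adj (v₂⊆u j) (v₁⊆v i) ∘ Adj-sym
    locate : ∀ {a} → a ∈ u ++ v → a ∈ v₁ ⊎ a ∈ v₂
    locate i = ∈-++⁻ v₁ (letters (proj₁ e) (∈-resp-↭ perm i))
    conclude : v₁ ≡ [] ⊎ v₂ ≡ [] → u ≡ [] ⊎ v ≡ []
    conclude (inj₁ refl) = inj₂ (∉⇒[] v λ j →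
      [ (λ ()) , (λ k → Unique-disjoint u Uuv (v₂⊆u k) j) ]′ (locate (∈-++⁺ʳ u j)))
    conclude (inj₂ refl) = inj₁ (∉⇒[] u λ i →
      [ (λ k → Unique-disjoint u Uuv i (v₁⊆v k)) , (λ ()) ]′ (locate (∈-++⁺ˡ i)))

  Src-++⁻ : ∀ u {v a} → Src a (u ++ v) → Src a u ⊎ (Src a v × (∀ {c} → c ∈ u → ¬ Adj c a))
  Src-++⁻ []      s = inj₂ (s , λ ())
  Src-++⁻ (b ∷ u) s with Src-∷⁻ s
  ... | inj₁ refl = inj₁ (here refl ,
    λ { e (here i) → proj₂ s e (here (∈-++⁺ˡ i)) ; e (there p) → proj₂ s e (there (bef-++ˡ p)) })
  ... | inj₂ (¬e , s′) with Src-++⁻ u s′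
  ...   | inj₁ s″        = inj₁ (Src-there ¬e s″)
  ...   | inj₂ (s″ , ¬f) = inj₂ (s″ , λ { (here refl) → ¬e ; (there i) → ¬f i })

  -- Moving the part v outside the pyramid from the bottom to the top of the heap enlarges the pyramid.
  conj-to-pyramid : ∀ {g x} k v t → Connected g → Unique (v ++ x ∷ t) → length v ℕ.≤ k →
                    Pyramid x (x ∷ t) → Conj G g (v ++ x ∷ t) → v ++ x ∷ t ↭ g →
                    ∃ λ e → Conj G g (x ∷ e) × Unique (x ∷ e) × Pyramid x (x ∷ e)
  conj-to-pyramid k [] t conn U l pyr conj perm = t , conj , U , pyr
  conj-to-pyramid {g} {x} (suc k) v@(_ ∷ _) t conn U l pyr conj perm
    -- `v₂` collects the pieces of `v` that are, or lie above, a neighbour of the pyramid; the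
    -- remaining part `v₁` commutes with the pyramid.
    with split (λ a → Any.any? (λ c → Adj? c a) (x ∷ t)) (Unique-++⁻ˡ v U)
  ... | v₁ , [] , e , U₁ , out , _
    with conn v (x ∷ t) perm (λ i j e′ → outside i j (Adj-sym e′))
    where
    outside : ∀ {a b} → a ∈ v → b ∈ x ∷ t → ¬ Adj b a
    outside {a} i j e′ = out (subst (a ∈_) (++-identityʳ v₁) (letters (proj₁ e) i))
                             (Any.map (λ { refl → e′ }) j)
  ...   | inj₁ ()
  ...   | inj₂ ()
  conj-to-pyramid {g} {x} (suc k) v@(_ ∷ _) t conn U l pyr conj perm
      | v₁ , v₂@(_ ∷ _) , e , U₁ , out , inn =
    conj-to-pyramid k v₁ (t ++ v₂) conn U′
      -- As `v₂` is nonempty, the part left outside gets shorter, and `k` bounds the number of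
      -- moves.
      (ℕ.≤-pred (ℕ.≤-trans (subst (length v₁ ℕ.<_) (≡-sym len) (ℕ.m<m+n (length v₁) ℕ.z<s)) l))
      pyr′ (conj ◅◅ (step ◅ ε)) perm′
    where
    len : length v ≡ length v₁ ℕ.+ length v₂
    len = trans (↭-length (≈⇒↭ (Unique-++⁻ˡ v U) U₁ e)) (length-++ v₁)
    moved : (x ∷ t) ++ v ≈ v₁ ++ (x ∷ t) ++ v₂
    moved = ≈-trans (≈-++ {x ∷ t} ≈-refl e)
      (subst₂ _≈_ (++-assoc (x ∷ t) v₁ v₂) (++-assoc v₁ (x ∷ t) v₂)
        (≈-++ {(x ∷ t) ++ v₁} (≈-commute (λ i j e′ → out j (Any.map (λ { refl → e′ }) i))) ≈-refl))
    perm₁ : v ++ x ∷ t ↭ v₁ ++ (x ∷ t) ++ v₂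
    perm₁ = ↭-trans (++⁺ʳ (x ∷ t) (≈⇒↭ (Unique-++⁻ˡ v U) U₁ e))
              (subst (_↭ v₁ ++ (x ∷ t) ++ v₂) (≡-sym (++-assoc v₁ v₂ (x ∷ t))) (++⁺ˡ v₁ (++-comm v₂ (x ∷ t))))
    U′ : Unique (v₁ ++ x ∷ t ++ v₂)
    U′ = Unique-↭ perm₁ U
    perm′ : v₁ ++ x ∷ t ++ v₂ ↭ g
    perm′ = ↭-trans (↭-sym perm₁) perm
    step : Conj₁ G (v ++ x ∷ t) (v₁ ++ x ∷ t ++ v₂)
    step = v , x ∷ t , ε , ≈⇒≃ U′ (Unique-↭ (++-comm v (x ∷ t)) U) (≈-sym moved)
    pyr′ : Pyramid x ((x ∷ t) ++ v₂)
    pyr′ s with Src-++⁻ (x ∷ t) s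
    ... | inj₁ s′ = pyr s′
    ... | inj₂ (s′ , ¬adj) = contradiction (inn s′) λ any → let (c , i , e′) = find any in ¬adj i e′

  -- With `x` the least vertex, write the heap as a product whose upper factor is the up-set of `x`,
  -- and conjugate it to a pyramid over `x`, whose largest word begins with `x`. By minimality the
  -- largest word of `g` begins with a letter at most `x`. That letter is the greatest minimal
  -- piece, so `x` is the only one.
  Lyndon⇒MinPyramid : ∀ {g} → Unique g → Lyndon G g → MinPyramid g
  Lyndon⇒MinPyramid {[]}    U (ne , _ , _) = contradiction refl ne
  Lyndon⇒MinPyramid {c ∷ r} U (ne , prim , minimal) with least c r
  ... | x , x∈g , low with split (Fin._≟ x) U
  ... | v₁ , [] , e , _ , out , _ =
    contradiction refl (out (subst (x ∈_) (++-identityʳ v₁) (letters (proj₁ e) x∈g)))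
  ... | v₁ , y ∷ t , e , U₂ , out , inn with inn (Src-here (Unique-++⁻ʳ v₁ U₂))
  ... | refl with conj-to-pyramid (length v₁) v₁ t (Primitive⇒Connected U prim) U₂ ℕ.≤-refl inn
                    -- A rotation with empty first part only replaces the word by another word of
                    -- the same heap.
                    (([] , c ∷ r , ε , subst (v₁ ++ x ∷ t ≃_) (≡-sym (++-identityʳ (c ∷ r))) (≃-sym g≃)) ◅ ε)
                    (↭-sym (≃⇒↭ g≃))
    where
    g≃ : c ∷ r ≃ v₁ ++ x ∷ t
    g≃ = ≈⇒≃ U U₂ e
  ... | t′ , conj , U′ , pyr′ with st U | st U′
  ... | s₁ , isSt₁ | s₂ , isSt₂ with IsSt-nonempty ne isSt₁ | IsSt-nonempty (λ ()) isSt₂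
  ... | b , s₁′ , refl | d , s₂′ , refl with pyr′ (IsSt-head U′ isSt₂)
  ... | refl = conclude λ src → Fin.≤-antisym
      (Fin.≤-trans (Src≤head U isSt₁ src) (≤lex-head (minimal _ conj _ _ isSt₁ isSt₂))) (low (proj₁ src))
    where
    conclude : Pyramid x (c ∷ r) → MinPyramid (c ∷ r)
    conclude pyr with pyr (Src-here U)
    ... | refl = minPyr (low ∘ there) pyr

  MinPyramid-head : ∀ {b t s} → Unique (b ∷ t) → MinPyramid (b ∷ t) → IsSt G (b ∷ t) s → ∃ λ s′ → s ≡ b ∷ s′
  MinPyramid-head U (minPyr _ pyr) isSt with IsSt-nonempty (λ ()) isSt
  ... | c , s′ , refl with pyr (IsSt-head U isSt)
  ... | refl = s′ , refl

  ≤H-head : ∀ {a b s t} → Unique (a ∷ s) → Unique (b ∷ t) → MinPyramid (a ∷ s) → MinPyramid (b ∷ t) →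
            _≤H_ G (a ∷ s) (b ∷ t) → a Fin.≤ b
  ≤H-head U U′ p q le with st U | st U′
  ... | _ , isSt | _ , isSt′ with MinPyramid-head U p isSt | MinPyramid-head U′ q isSt′
  ... | _ , refl | _ , refl = ≤lex-head (le _ _ isSt isSt′)

  head-≤H : ∀ {a b s t} → Unique (a ∷ s) → Unique (b ∷ t) → MinPyramid (a ∷ s) → MinPyramid (b ∷ t) →
            a Fin.< b → _≤H_ G (a ∷ s) (b ∷ t)
  head-≤H U U′ p q lt _ _ isSt isSt′ with MinPyramid-head U p isSt | MinPyramid-head U′ q isSt′
  ... | _ , refl | _ , refl = head< lt
  -- Enumeration of Lyndon factorizations

  nbrs nonNbrs : V → W → W
  nbrs x    = filter (Adj? x)
  nonNbrs x = filter (¬? ∘ Adj? x)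

  nbrs-++-nonNbrs : ∀ x B → nbrs x B ++ nonNbrs x B ↭ B
  nbrs-++-nonNbrs x [] = ↭-refl
  nbrs-++-nonNbrs x (b ∷ B) with adj G x b
  ... | true  = prep b (nbrs-++-nonNbrs x B)
  ... | false = ↭-trans (shift b (nbrs x B) (nonNbrs x B)) (prep b (nbrs-++-nonNbrs x B))

  take-nbrs : ∀ x (A B : W) → (A ++ nbrs x B) ++ nonNbrs x B ↭ A ++ B
  take-nbrs x A B rewrite ++-assoc A (nbrs x B) (nonNbrs x B) = ++⁺ˡ A (nbrs-++-nonNbrs x B)

  -- The recursion shared by the colouring count and the enumeration of heaps.  A lists the candidates
  -- for the next letter of the Lyndon factor under construction, B the other unused vertices.
  data Run : W → W → Set where
    done  : Run [] []
    start : ∀ {x B B′} → B ↭ x ∷ B′ → (∀ {b} → b ∈ B → x Fin.≤ b) →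
           Run (nbrs x B′) (nonNbrs x B′) → Run [] B
    grow  : ∀ {y A B} → Run A (y ∷ B) → Run (A ++ nbrs y B) (nonNbrs y B) → Run (y ∷ A) B

  run-bounded : ∀ k A B → length (A ++ B) ℕ.≤ k → Run A B
  run-bounded k       []      []      l = done
  run-bounded (suc k) []      (b ∷ B) l with least b B
  ... | x , i , low with ∈-∃++ i
  ... | p , r , eq = start perm low (run-bounded k (nbrs x (p ++ r)) (nonNbrs x (p ++ r))
          (ℕ.≤-pred (ℕ.≤-trans (ℕ.≤-reflexive (cong suc (↭-length (nbrs-++-nonNbrs x (p ++ r)))))
                               (subst (ℕ._≤ suc k) (↭-length perm) l))))
    where
    perm : b ∷ B ↭ x ∷ p ++ r
    perm = subst (_↭ x ∷ p ++ r) (≡-sym eq) (shift x p r)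
  run-bounded (suc k) (y ∷ A) B l = grow
    (run-bounded (suc k) A (y ∷ B) (subst (ℕ._≤ suc k) (↭-length (↭-sym (shift y A B))) l))
    (run-bounded k (A ++ nbrs y B) (nonNbrs y B)
      (subst (ℕ._≤ k) (≡-sym (↭-length (take-nbrs y A B))) (ℕ.≤-pred l)))

  run : ∀ A B → Run A B
  run A B = run-bounded _ A B ℕ.≤-refl

  Path : Set
  Path = W × List W

  -- A path (e , fs) consists of the rest e of the current factor and the factors fs to its left, last one first.
  paths : ∀ {A B} → Run A B → List Path
  paths done               = ([] , []) ∷ []
  paths (start {x} _ _ r)  = map (λ (e , fs) → [] , (x ∷ e) ∷ fs) (paths r)
  paths (grow {y} r s)     = paths r ++ map (λ (e , fs) → y ∷ e , fs) (paths s)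

  -- Factors are listed from the last to the first. The second condition makes `x ∷ t` a pyramid, by
  -- `Pyramid-∷`; the first replaces the lexicographic comparison of successive factors by a
  -- comparison of their heads.
  data ReverseFactors : List W → Set where
    []  : ReverseFactors []
    fac : ∀ {x t fs} → (∀ {a} → a ∈ t ++ concat fs → x Fin.≤ a) → (∀ {a} → Src a t → Adj x a) →
          ReverseFactors fs → ReverseFactors ((x ∷ t) ∷ fs)

  paths-sound : ∀ {A B} (r : Run A B) {e fs} → (e , fs) ∈ paths r →
                (e ++ concat fs ↭ A ++ B) × (∀ {a} → Src a e → a ∈ A) × ReverseFactors fs
  paths-sound done (here refl) = ↭-refl , (λ { (() , _) }) , []
  paths-sound (start {x} {B} {B′} perm low r) i with ∈-map⁻ _ i
  ... | (e , fs) , j , refl with paths-sound r j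
  ... | p , roots , F =
    ↭-trans (prep x p′) (↭-sym perm) , (λ { (() , _) }) ,
    fac (λ k → low (∈-resp-↭ (↭-sym perm) (there (∈-resp-↭ p′ k))))
        (λ s → proj₂ (∈-filter⁻ (Adj? x) {xs = B′} (roots s))) F
    where
    p′ : e ++ concat fs ↭ B′
    p′ = ↭-trans p (nbrs-++-nonNbrs x B′)
  paths-sound (grow {y} {A} {B} r s) i with ∈-++⁻ (paths r) i
  ... | inj₁ j = let (p , roots , F) = paths-sound r j in
    ↭-trans p (shift y A B) , there ∘ roots , F
  ... | inj₂ j with ∈-map⁻ _ j
  ... | (e , fs) , k , refl with paths-sound s k
  ... | p , roots , F = prep y (↭-trans p (take-nbrs y A B)) , roots′ , F
    where
    roots′ : ∀ {a} → Src a (y ∷ e) → a ∈ y ∷ A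
    roots′ src with Src-∷⁻ src
    ... | inj₁ refl = here refl
    ... | inj₂ (¬e , src′) with ∈-++⁻ A (roots src′)
    ...   | inj₁ q = there q
    ...   | inj₂ q = contradiction (proj₂ (∈-filter⁻ (Adj? y) {xs = B} q)) ¬e

  _≋_ : List W → List W → Set
  _≋_ = Pointwise _≈_

  no-src⇒[] : ∀ {t} → Unique t → (∀ {a} → ¬ Src a t) → t ≡ []
  no-src⇒[] {[]}    U f = refl
  no-src⇒[] {a ∷ t} U f = contradiction (Src-here U) f

  paths-complete : ∀ {A B} (r : Run A B) {t gs} → Unique (t ++ concat gs) → t ++ concat gs ↭ A ++ B →
                   (∀ {a} → Src a t → a ∈ A) → ReverseFactors gs →
                   ∃₂ λ e fs → (e , fs) ∈ paths r × e ≈ t × fs ≋ gs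
  paths-complete done {[]}    U perm roots []          = [] , [] , here refl , ≈-refl , []
  paths-complete done {[]}    U perm roots (fac _ _ _) with ↭-empty-inv perm
  ... | ()
  paths-complete done {_ ∷ _} U perm roots _           with ↭-empty-inv perm
  ... | ()
  paths-complete (start {x} {B} {B′} perm low r) {t} U p roots F
    with no-src⇒[] (Unique-++⁻ˡ t U) (λ s → contradiction (roots s) λ ())
  paths-complete (start perm low r) U p roots [] | refl with ↭-empty-inv (↭-sym (↭-trans p perm))
  ... | ()
  paths-complete (start {x} {B} {B′} perm low r) U p roots (fac {x′} {t′} {gs} low′ adj F) | refl
    with Fin.≤-antisym (low (∈-resp-↭ p (here refl))) (min′ (∈-resp-↭ (↭-sym (↭-trans p perm)) (here refl)))
    where
    min′ : ∀ {a} → a ∈ x′ ∷ t′ ++ concat gs → x′ Fin.≤ a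
    min′ (here refl) = Fin.≤-refl
    min′ (there i)   = low′ i
  ... | refl with paths-complete r (AllPairs.tail U) (↭-trans rest (↭-sym (nbrs-++-nonNbrs x B′))) roots′ F
    where
    rest : t′ ++ concat gs ↭ B′
    rest = drop-∷ (↭-trans p perm)
    roots′ : ∀ {a} → Src a t′ → a ∈ nbrs x B′
    roots′ s = ∈-filter⁺ (Adj? x) (∈-resp-↭ rest (∈-++⁺ˡ (proj₁ s))) (adj s)
  ... | e , fs , i , e≈ , fs≋ =
    [] , (x ∷ e) ∷ fs , ∈-map⁺ _ i , ≈-refl , ≈-++ {x ∷ []} ≈-refl e≈ ∷ fs≋
  paths-complete (grow {y} {A} {B} r s) {t} {gs} U p roots F with Src? y (Unique-++⁻ˡ t U)
  ... | no ¬src = let (e , fs , i , rest) = paths-complete r U (↭-trans p (↭-sym (shift y A B))) roots′ F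
                  in e , fs , ∈-++⁺ˡ i , rest
    where
    roots′ : ∀ {a} → Src a t → a ∈ A
    roots′ s with roots s
    ... | here refl = contradiction s ¬src
    ... | there i   = i
  ... | yes src with Src-split (Unique-++⁻ˡ t U) src
  ... | u , t≃ , U′ = let (e , fs , i , e≈ , fs≋) = paths-complete s U″ p″ roots″ F in
    y ∷ e , fs , ∈-++⁺ʳ (paths r) (∈-map⁺ _ i) ,
    ≈-trans (≈-++ {y ∷ []} ≈-refl e≈) (≈-sym (≃⇒≈ t≃)) , fs≋
    where
    perm : t ++ concat gs ↭ y ∷ u ++ concat gs
    perm = ++⁺ʳ (concat gs) (≃⇒↭ t≃)
    U″ : Unique (u ++ concat gs)
    U″ = AllPairs.tail (Unique-↭ perm U)
    p′ : u ++ concat gs ↭ A ++ B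
    p′ = drop-∷ (↭-trans (↭-sym perm) p)
    p″ : u ++ concat gs ↭ (A ++ nbrs y B) ++ nonNbrs y B
    p″ = ↭-trans p′ (↭-sym (take-nbrs y A B))
    roots″ : ∀ {a} → Src a u → a ∈ A ++ nbrs y B
    roots″ {a} src′ with Adj? y a
    ... | no ¬e with roots (Src-resp (≈-sym (≃⇒≈ t≃)) (Src-there ¬e src′))
    ...   | here refl = contradiction (proj₁ src′) (Unique-head U′)
    ...   | there i   = ∈-++⁺ˡ i
    roots″ {a} src′ | yes e with ∈-++⁻ A (∈-resp-↭ p′ (∈-++⁺ˡ (proj₁ src′)))
    ...   | inj₁ i = ∈-++⁺ˡ i
    ...   | inj₂ i = ∈-++⁺ʳ A (∈-filter⁺ (Adj? y) i e)

  Distinct : Path → Path → Set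
  Distinct (e , fs) (e′ , fs′) = e ≈ e′ → ¬ fs ≋ fs′

  -- The two branches at `y` differ in whether `y` is a minimal piece of the rest `e`: in the
  -- postponing branch all minimal pieces come from `A`, which does not contain `y`.
  paths-distinct : ∀ {A B} (r : Run A B) → Unique (A ++ B) → AllPairs Distinct (paths r)
  paths-distinct done U = [] ∷ []
  paths-distinct (start {x} {B} {B′} perm low r) U = AllPairs.map⁺ (AllPairs-∈ distinct (paths-distinct r U′))
    where
    Ux : Unique (x ∷ B′)
    Ux = Unique-↭ perm U
    U′ : Unique (nbrs x B′ ++ nonNbrs x B′)
    U′ = Unique-↭ (↭-sym (nbrs-++-nonNbrs x B′)) (AllPairs.tail Ux)
    Ux∷e : ∀ {e fs} → (e , fs) ∈ paths r → Unique (x ∷ e)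
    Ux∷e {e} i = Unique-++⁻ˡ (x ∷ e)
      (Unique-↭ (prep x (↭-sym (↭-trans (proj₁ (paths-sound r i)) (nbrs-++-nonNbrs x B′)))) Ux)
    distinct : ∀ {p q} → p ∈ paths r → q ∈ paths r → Distinct p q →
               Distinct ([] , (x ∷ proj₁ p) ∷ proj₂ p) ([] , (x ∷ proj₁ q) ∷ proj₂ q)
    distinct i j d _ (e≈ ∷ fs≋) = d (≈-∷⁻ (Ux∷e i) (Ux∷e j) e≈) fs≋
  paths-distinct (grow {y} {A} {B} r s) U =
    AllPairs.++⁺ (paths-distinct r (Unique-↭ (↭-sym (shift y A B)) U))
      (AllPairs.map⁺ (AllPairs-∈ distinct (paths-distinct s U′)))
      (All.tabulate λ i → All.tabulate λ j → cross i j)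
    where
    U′ : Unique ((A ++ nbrs y B) ++ nonNbrs y B)
    U′ = Unique-↭ (↭-sym (take-nbrs y A B)) (AllPairs.tail U)
    Uy∷e : ∀ {e fs} → (e , fs) ∈ paths s → Unique (y ∷ e)
    Uy∷e {e} i = Unique-++⁻ˡ (y ∷ e)
      (Unique-↭ (prep y (↭-sym (↭-trans (proj₁ (paths-sound s i)) (take-nbrs y A B)))) U)
    distinct : ∀ {p q} → p ∈ paths s → q ∈ paths s → Distinct p q →
               Distinct (y ∷ proj₁ p , proj₂ p) (y ∷ proj₁ q , proj₂ q)
    distinct i j d e≈ = d (≈-∷⁻ (Uy∷e i) (Uy∷e j) e≈)
    cross : ∀ {p q} → p ∈ paths r → q ∈ map (λ (e , fs) → y ∷ e , fs) (paths s) → Distinct p q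
    cross i j e≈ _ with ∈-map⁻ _ j
    ... | _ , k , refl = Unique-head U (∈-++⁺ˡ
      (proj₁ (proj₂ (paths-sound r i)) (Src-resp (≈-sym e≈) (Src-here (Uy∷e k)))))

  -- Uniqueness of the Lyndon factorization

  assemble : List W → W
  assemble []       = []
  assemble (g ∷ fs) = assemble fs ++ g

  concat-reverse : ∀ fs → concat (reverse fs) ≡ assemble fs
  concat-reverse []       = refl
  concat-reverse (g ∷ fs) = trans (cong concat (unfold-reverse g fs))
    (trans (≡-sym (concat-++ (reverse fs) (g ∷ [])))
           (cong₂ _++_ (concat-reverse fs) (++-identityʳ g)))

  assemble-↭ : ∀ fs → assemble fs ↭ concat fs
  assemble-↭ []       = ↭-refl
  assemble-↭ (g ∷ fs) = ↭-trans (++-comm (assemble fs) g) (++⁺ˡ g (assemble-↭ fs))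

  -- Everything in `x ∷ t` lies above `x`, and along an edge going up from a letter of `x ∷ t′` one
  -- cannot get back into `v′`.
  final-pyramid-⊆ : ∀ {x t v v′ t′} → Unique (v ++ x ∷ t) → Unique (v′ ++ x ∷ t′) → Pyramid x (x ∷ t) →
                    v ++ x ∷ t ≈ v′ ++ x ∷ t′ → ∀ {a} → a ∈ x ∷ t → a ∈ x ∷ t′
  final-pyramid-⊆ {x} {t} {v} {v′} {t′} U U′ pyr (f , _) =
    Src-propagate (Unique-++⁻ʳ v U) (λ s → here (pyr s)) step′
    where
    step′ : ∀ {a b} → Adj a b → Bef (x ∷ t) a b → a ∈ x ∷ t′ → b ∈ x ∷ t′
    step′ e p i with bef-++⁻ v′ (order f e (bef-++ʳ v p))
    ... | inj₁ q              = contradiction i (Unique-disjoint v′ U′ (bef-∈ˡ q))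
    ... | inj₂ (inj₁ (_ , j)) = j
    ... | inj₂ (inj₂ q)       = bef-∈ʳ q

  -- The head of the last factor is the least vertex and the factor is its up-set, so the two lists
  -- agree in their first entries, which are then cancelled.
  factors-unique : ∀ {fs gs} → ReverseFactors fs → ReverseFactors gs →
                   Unique (assemble fs) → Unique (assemble gs) →
                   assemble fs ≈ assemble gs → fs ≋ gs
  factors-unique []          []          _ _ _ = []
  factors-unique [] (fac {fs = gs} _ _ _) _ _ (_ , g) with letters g (∈-++⁺ʳ (assemble gs) (here refl))
  ... | ()
  factors-unique (fac {fs = fs} _ _ _) [] _ _ (f , _) with letters f (∈-++⁺ʳ (assemble fs) (here refl))
  ... | ()
  factors-unique (fac {x} {t} {fs} low adj F) (fac {x′} {t′} {gs} low′ adj′ F′) U U′ eq@(f , g)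
    with Fin.≤-antisym (min low (perm {fs} (letters g (∈-++⁺ʳ (assemble gs) (here refl)))))
                       (min low′ (perm {gs} (letters f (∈-++⁺ʳ (assemble fs) (here refl)))))
    where
    min : ∀ {x t} → (∀ {a} → a ∈ t → x Fin.≤ a) → ∀ {a} → a ∈ x ∷ t → x Fin.≤ a
    min low (here refl) = Fin.≤-refl
    min low (there i)   = low i
    perm : ∀ {fs x t a} → a ∈ assemble fs ++ x ∷ t → a ∈ x ∷ t ++ concat fs
    perm {fs} {x} {t} = ∈-resp-↭ (assemble-↭ ((x ∷ t) ∷ fs))
  ... | refl =
    let (r , e) = ≈-cancel (assemble fs) (assemble gs) U U′ eq
                    (final-pyramid-⊆ U U′ (Pyramid-∷ adj) eq)
                    (final-pyramid-⊆ U′ U (Pyramid-∷ adj′) (≈-sym eq))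
    in e ∷ factors-unique F F′ (Unique-++⁻ˡ (assemble fs) U) (Unique-++⁻ˡ (assemble gs) U′) r

  -- Lyndon factorizations and lists of pyramids

  _⊒H_ : W → W → Set
  u ⊒H v = _≤H_ G v u

  Factors : List W → Set
  Factors es = All (Lyndon G) es × Linked _⊒H_ es

  fac⇒MinPyramid : ∀ {x t fs} → (∀ {a} → a ∈ t ++ concat fs → x Fin.≤ a) → (∀ {a} → Src a t → Adj x a) →
                   MinPyramid (x ∷ t)
  fac⇒MinPyramid low adj = minPyr (low ∘ ∈-++⁺ˡ) (Pyramid-∷ adj)

  -- Reversal with an accumulator: `g` has been moved already, and the head of the next factor is
  -- strictly larger because the letters are distinct. Different heads settle the lexicographic
  -- comparison.
  factors-ʳ++ : ∀ {g fs} es → ReverseFactors (g ∷ fs) → Unique (g ++ concat fs) → Factors (g ∷ es) →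
                Factors (fs ʳ++ (g ∷ es))
  factors-ʳ++ {fs = []}     es F U L = L
  factors-ʳ++ {g} {f ∷ fs} es (fac {x} {t} low adj F@(fac {y} {s} low′ adj′ _)) U (ls , lk) =
    factors-ʳ++ (g ∷ es) F Uf (MinPyramid⇒Lyndon Uys my ∷ ls ,
      head-≤H Uxt Uys (fac⇒MinPyramid {fs = f ∷ fs} low adj) my x<y ∷ lk)
    where
    Uf : Unique ((y ∷ s) ++ concat fs)
    Uf = Unique-++⁻ʳ g U
    Uxt : Unique (x ∷ t)
    Uxt = Unique-++⁻ˡ g U
    Uys : Unique (y ∷ s)
    Uys = Unique-++⁻ˡ (y ∷ s) Uf
    my : MinPyramid (y ∷ s)
    my = fac⇒MinPyramid {fs = fs} low′ adj′
    x<y : x Fin.< y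
    x<y = Fin.≤∧≢⇒< (low (∈-++⁺ʳ t (here refl))) (λ { refl → Unique-head U (∈-++⁺ʳ t (here refl)) })

  reverse-factors : ∀ {fs} → ReverseFactors fs → Unique (concat fs) → Factors (reverse fs)
  reverse-factors []                        U = [] , []
  reverse-factors F@(fac {x} {t} {fs} low adj _) U =
    factors-ʳ++ [] F U (MinPyramid⇒Lyndon (Unique-++⁻ˡ (x ∷ t) U) (fac⇒MinPyramid {fs = fs} low adj) ∷ [] , [-])

  -- Invariant of the reversal: the head of the factor to be moved next is at most every letter
  -- moved so far.
  data Bounds : List W → List W → Set where
    none : ∀ {fs} → Bounds [] fs
    some : ∀ {x t es fs} → (∀ {a} → a ∈ concat fs → x Fin.≤ a) → Bounds ((x ∷ t) ∷ es) fs

  ʳ++-reverseFactors : ∀ es {fs} → Factors es → Unique (concat es) → ReverseFactors fs → Bounds es fs →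
                       ReverseFactors (es ʳ++ fs)
  ʳ++-reverseFactors []       _ _ F _ = F
  ʳ++-reverseFactors (e ∷ es) {fs} (l ∷ ls , lk) U F bound with Lyndon⇒MinPyramid (Unique-++⁻ˡ e U) l | bound
  ... | m@(minPyr {x} {t} low pyr) | some bound′ =
    ʳ++-reverseFactors es (ls , tailLinked lk) (Unique-++⁻ʳ e U)
      (fac low′ (Pyramid-tail (Unique-++⁻ˡ e U) pyr) F) (next es ls lk U)
    where
    tailLinked : ∀ {es} → Linked _⊒H_ (e ∷ es) → Linked _⊒H_ es
    tailLinked [-]      = []
    tailLinked (_ ∷ lk) = lk
    low′ : ∀ {a} → a ∈ t ++ concat fs → x Fin.≤ a
    low′ = [ low , bound′ ]′ ∘ ∈-++⁻ t
    next : ∀ es → All (Lyndon G) es → Linked _⊒H_ (e ∷ es) → Unique (e ++ concat es) → Bounds es ((x ∷ t) ∷ fs)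
    next []       _        _        U = none
    next (f ∷ es) (l ∷ ls) (le ∷ _) U with Unique-++⁻ˡ f (Unique-++⁻ʳ e U)
    ... | Uf with Lyndon⇒MinPyramid Uf l
    -- The factors weakly decrease, hence so do their heads, and `y` inherits the bounds of `x`.
    ... | m′@(minPyr {y} _ _) = some λ { (here refl) → y≤x ; (there i) → Fin.≤-trans y≤x (low′ i) }
      where
      y≤x : y Fin.≤ x
      y≤x = ≤H-head Uf (Unique-++⁻ˡ e U) m′ m le

  factors-reverse : ∀ {es} → Factors es → Unique (concat es) → ReverseFactors (reverse es)
  factors-reverse {[]}     L U = []
  factors-reverse {e ∷ es} L@(l ∷ _ , _) U =
    ʳ++-reverseFactors (e ∷ es) L U [] (bound (Lyndon⇒MinPyramid (Unique-++⁻ˡ e U) l))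
    where
    bound : ∀ {e} → MinPyramid e → Bounds (e ∷ es) []
    bound (minPyr _ _) = some λ ()
  -- Colourings

  -- Proper colourings of the subgraph on S, avoiding the colour 0 on A; outside S the colour is set to 0
  -- so that the vector is determined by the colouring.
  record Colouring (p : ℕ) (A S : W) (c : Vec (Fin (suc p)) n) : Set where
    constructor colouring
    field
      proper  : ∀ {a b} → a ∈ S → b ∈ S → Adj a b → lookup c a ≢ lookup c b
      avoids  : ∀ {a} → a ∈ A → lookup c a ≢ Fin.zero
      outside : ∀ {a} → a ∉ S → lookup c a ≡ Fin.zero
  open Colouring

  module _ {p : ℕ} where

    avoid-new : ∀ {y A S S′ c} → S ↭ S′ → Colouring p A S c → lookup c y ≢ Fin.zero → Colouring p (y ∷ A) S′ c
    avoid-new perm (colouring pr av out) ne = colouring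
      (λ i j → pr (∈-resp-↭ (↭-sym perm) i) (∈-resp-↭ (↭-sym perm) j))
      (λ { (here refl) → ne ; (there i) → av i })
      (λ i → out (i ∘ ∈-resp-↭ perm))

    avoid-old : ∀ {y A S S′ c} → S ↭ S′ → Colouring p (y ∷ A) S′ c → Colouring p A S c × lookup c y ≢ Fin.zero
    avoid-old perm (colouring pr av out) = colouring
      (λ i j → pr (∈-resp-↭ perm i) (∈-resp-↭ perm j)) (av ∘ there)
      (λ i → out (i ∘ ∈-resp-↭ (↭-sym perm))) , av (here refl)

    -- The vector stays the same: a removed vertex of colour 0 already carries the default colour
    -- required outside the vertex set. Its neighbours could not have colour 0, which accounts for
    -- `A′`.
    remove-zero : ∀ {y A A′ S S′ c} → S ↭ y ∷ S′ → (∀ {a} → a ∈ A′ → a ∈ A ⊎ (a ∈ S′ × Adj y a)) →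
                  Colouring p A S c → lookup c y ≡ Fin.zero → Colouring p A′ S′ c
    remove-zero {y} {A} {A′} {S} {S′} {c} perm A′⊆ (colouring pr av out) eq = colouring
      (λ i j → pr (S′⊆S i) (S′⊆S j)) ([ av , av′ ]′ ∘ A′⊆) out′
      where
      S′⊆S : ∀ {a} → a ∈ S′ → a ∈ S
      S′⊆S = ∈-resp-↭ (↭-sym perm) ∘ there
      av′ : ∀ {a} → a ∈ S′ × Adj y a → lookup c a ≢ Fin.zero
      av′ (i , e) eq′ = pr (∈-resp-↭ (↭-sym perm) (here refl)) (S′⊆S i) e (trans eq (≡-sym eq′))
      out′ : ∀ {a} → a ∉ S′ → lookup c a ≡ Fin.zero
      out′ {a} a∉S′ with a Fin.≟ y
      ... | yes refl = eq
      ... | no a≢y   = out λ i → [ a≢y , a∉S′ ]′ (head-tail (∈-resp-↭ perm i))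
        where
        head-tail : ∀ {a b : V} {u} → a ∈ b ∷ u → a ≡ b ⊎ a ∈ u
        head-tail (here eq) = inj₁ eq
        head-tail (there i) = inj₂ i

    insert-zero : ∀ {y A A′ S S′ c} → S ↭ y ∷ S′ → y ∉ S′ → (∀ {a} → a ∈ A → a ∈ A′) →
                  (∀ {a} → a ∈ S′ → Adj y a → a ∈ A′) →
                  Colouring p A′ S′ c → Colouring p A S c × lookup c y ≡ Fin.zero
    insert-zero {y} {A} {A′} {S} {S′} {c} perm y∉S′ A⊆ N⊆ (colouring pr av out) =
      colouring (λ i j → pr′ (∈-resp-↭ perm i) (∈-resp-↭ perm j)) (av ∘ A⊆)
                (λ a∉S → out (a∉S ∘ ∈-resp-↭ (↭-sym perm) ∘ there)) ,
      out y∉S′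
      where
      pr′ : ∀ {a b} → a ∈ y ∷ S′ → b ∈ y ∷ S′ → Adj a b → lookup c a ≢ lookup c b
      pr′ (here refl) (here refl) e    = contradiction e Adj-irrefl
      pr′ (here refl) (there j)   e eq = av (N⊆ j e) (trans (≡-sym eq) (out y∉S′))
      pr′ (there i)   (here refl) e eq = av (N⊆ i (Adj-sym e)) (trans eq (out y∉S′))
      pr′ (there i)   (there j)   e    = pr i j e

    recolour-at : ∀ {P : Set} → Dec P → (i j k : Fin (suc p)) → Fin (suc p)
    recolour-at (yes _) i j k = transpose i j k
    recolour-at (no _)  i j k = Fin.zero

    recolour : W → (i j : Fin (suc p)) → Vec (Fin (suc p)) n → Vec (Fin (suc p)) n
    recolour S i j c = tabulate (λ a → recolour-at (a ∈? S) i j (lookup c a))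

    recolour-∈ : ∀ {S a} i j c → a ∈ S → lookup (recolour S i j c) a ≡ transpose i j (lookup c a)
    recolour-∈ {S} {a} i j c a∈S = trans (lookup∘tabulate _ a) (at (a ∈? S))
      where
      at : (d : Dec (a ∈ S)) → recolour-at d i j (lookup c a) ≡ transpose i j (lookup c a)
      at (yes _)  = refl
      at (no a∉S) = contradiction a∈S a∉S

    recolour-∉ : ∀ {S a} i j c → a ∉ S → lookup (recolour S i j c) a ≡ Fin.zero
    recolour-∉ {S} {a} i j c a∉S = trans (lookup∘tabulate _ a) (at (a ∈? S))
      where
      at : (d : Dec (a ∈ S)) → recolour-at d i j (lookup c a) ≡ Fin.zero
      at (yes a∈S) = contradiction a∈S a∉S
      at (no _)    = refl

    transpose-left : ∀ (i j : Fin (suc p)) → transpose i j i ≡ j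
    transpose-left i j rewrite dec-true (i Fin.≟ i) refl = refl

    transpose-injective : ∀ (i j : Fin (suc p)) {k l} → transpose i j k ≡ transpose i j l → k ≡ l
    transpose-injective i j eq =
      trans (≡-sym (transpose-inverse j i)) (trans (cong (transpose j i) eq) (transpose-inverse j i))

    recolour-colouring : ∀ {x S} i j c → x ∈ S → Colouring p [] S c × lookup c x ≡ i →
      (Colouring p [] S (recolour S i j c) × lookup (recolour S i j c) x ≡ j) ×
      recolour S j i (recolour S i j c) ≡ c
    recolour-colouring {x} {S} i j c x∈S (colouring pr av out , eq) =
      (colouring (λ a∈S b∈S e eq′ → pr a∈S b∈S e (transpose-injective i j
                   (trans (≡-sym (recolour-∈ i j c a∈S)) (trans eq′ (recolour-∈ i j c b∈S)))))
                 (λ ()) (recolour-∉ i j c) ,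
       trans (recolour-∈ i j c x∈S) (trans (cong (transpose i j) eq) (transpose-left i j))) ,
      vec-ext inverse
      where
      c′ : Vec (Fin (suc p)) n
      c′ = recolour S i j c
      inverse : ∀ a → lookup (recolour S j i c′) a ≡ lookup c a
      inverse a with a ∈? S
      ... | yes a∈S = trans (recolour-∈ j i c′ a∈S)
        (trans (cong (transpose j i) (recolour-∈ i j c a∈S)) (transpose-inverse j i))
      ... | no a∉S  = trans (recolour-∉ j i c′ a∉S) (≡-sym (out a∉S))

    -- Exchanging the colours 0 and k matches the colourings with colour 0 at x with those with colour k at x.
    Card-by-symmetry : ∀ {x S N} → x ∈ S → Card (λ c → Colouring p [] S c × lookup c x ≡ Fin.zero) N →
                       Card (Colouring p [] S) (suc p ℕ.* N)
    Card-by-symmetry {x} {S} {N} x∈S card =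
      subst (Card (Colouring p [] S))
        (trans (sum-const (allFin (suc p)) N) (cong (ℕ._* N) (length-tabulate {n = suc p} (λ k → k))))
        (Card-resp (λ c → proj₁ ∘ proj₂ ∘ proj₂ ∘ find) (λ c col → lose (∈-allFin (lookup c x)) (col , refl))
          (Card-Any (allFin (suc p))
            (All.tabulate λ {k} _ → Card-image (recolour S Fin.zero k) (recolour S k Fin.zero)
              (λ c → recolour-colouring Fin.zero k c x∈S) (λ c → recolour-colouring k Fin.zero c x∈S) card)
            (AllPairs.map (λ k≢l c (_ , e) (_ , e′) → k≢l (trans (≡-sym e) e′)) (Unique.allFin⁺ (suc p)))))

  -- The number of letters that are not heads of their factors; each of them contributes a sign.
  excess : List W → ℕ
  excess []       = 0
  excess (f ∷ fs) = ℕ.pred (length f) ℕ.+ excess fs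

  sign : Path → ℤ
  sign (e , fs) = -1^ (length e ℕ.+ excess fs)

  degree : Path → ℕ
  degree (e , fs) = length fs

  -- The term of the path at q = p + 1; the number of colours is a successor so that the colour 0
  -- exists.
  weight : ℕ → Path → ℤ
  weight p π = sign π ℤ.* (+ suc p) ℤ.^ degree π

  weight-start : ∀ p x e fs → weight p ([] , (x ∷ e) ∷ fs) ≡ + suc p ℤ.* weight p (e , fs)
  weight-start p x e fs = solve 3 (λ s q r → s :* (q :* r) := q :* (s :* r)) refl
    (sign (e , fs)) (+ suc p) ((+ suc p) ℤ.^ length fs)

  weight-grow : ∀ p y e fs → weight p (y ∷ e , fs) ≡ -[1+ 0 ] ℤ.* weight p (e , fs)
  weight-grow p y e fs = ℤ.*-assoc -[1+ 0 ] (sign (e , fs)) ((+ suc p) ℤ.^ length fs)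

  -- Induction over the run. Starting a factor at `x` multiplies the count by q, by symmetry of the
  -- colours. At a candidate `y` the colourings with colour 0 at `y` are subtracted, which matches
  -- the sign of the extra letter on the paths through `s`.
  colouring-count : ∀ p {A B} (r : Run A B) → Unique (A ++ B) →
                    Σ ℕ λ N → Card (Colouring p A (A ++ B)) N × + N ≡ Σℤ (weight p) (paths r)
  colouring-count p done U = 1 ,
    Card-singleton (replicate n Fin.zero)
      (colouring (λ ()) (λ ()) (λ {a} _ → lookup-replicate a Fin.zero))
      (λ c col → vec-ext λ a → trans (outside col (λ ())) (≡-sym (lookup-replicate a Fin.zero))) ,
    refl
  colouring-count p (start {x} {B} {B′} perm low r) U with colouring-count p r U′
    where
    U′ : Unique (nbrs x B′ ++ nonNbrs x B′)
    U′ = Unique-↭ (↭-sym (nbrs-++-nonNbrs x B′)) (AllPairs.tail (Unique-↭ perm U))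
  ... | N , card , eq = suc p ℕ.* N ,
    Card-by-symmetry (∈-resp-↭ (↭-sym perm) (here refl)) (Card-resp
      (λ c → insert-zero perm′ x∉ (λ ()) (λ i e → ∈-filter⁺ (Adj? x) (∈-resp-↭ (nbrs-++-nonNbrs x B′) i) e))
      (λ c (col , e) → remove-zero perm′
        (λ i → inj₂ (∈-++⁺ˡ i , proj₂ (∈-filter⁻ (Adj? x) {xs = B′} i))) col e) card) ,
    (begin
      + (suc p ℕ.* N)                          ≡⟨ ℤ.pos-* (suc p) N ⟩
      + suc p ℤ.* + N                          ≡⟨ cong (+ suc p ℤ.*_) eq ⟩
      + suc p ℤ.* Σℤ (weight p) (paths r)      ≡⟨ Σℤ-*ˡ (+ suc p) (weight p) (paths r) ⟨
      Σℤ (λ π → + suc p ℤ.* weight p π) (paths r)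
        ≡⟨ Σℤ-cong (paths r) (λ {π} _ → weight-start p x (proj₁ π) (proj₂ π)) ⟨
      Σℤ (λ (e , fs) → weight p ([] , (x ∷ e) ∷ fs)) (paths r)
        ≡⟨ Σℤ-map (weight p) _ (paths r) ⟨
      Σℤ (weight p) (paths (start perm low r)) ∎)
    where
    open ≡-Reasoning
    perm′ : B ↭ x ∷ nbrs x B′ ++ nonNbrs x B′
    perm′ = ↭-trans perm (prep x (↭-sym (nbrs-++-nonNbrs x B′)))
    x∉ : x ∉ nbrs x B′ ++ nonNbrs x B′
    x∉ = Unique-head (Unique-↭ perm′ U)
  colouring-count p (grow {y} {A} {B} r s) U
    with colouring-count p r (Unique-↭ (↭-sym (shift y A B)) U)
       | colouring-count p s (Unique-↭ (↭-sym (take-nbrs y A B)) (AllPairs.tail U))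
  ... | L , cardL , eqL | N , cardN , eqN
    with Card-filter (λ c → ¬? (lookup c y Fin.≟ Fin.zero)) cardL
  ... | M , cardM = M ,
    Card-resp (λ c (col , ne) → avoid-new (shift y A B) col ne) (λ c → avoid-old (shift y A B)) cardM ,
    (begin
      + M
        -- As L = M + N, the count M is the difference L - N of the counts of the two branches.
        ≡⟨ solve 2 (λ m k → m := (m :+ k) :+ con -[1+ 0 ] :* k) refl (+ M) (+ N) ⟩
      + (M ℕ.+ N) ℤ.+ -[1+ 0 ] ℤ.* + N
        ≡⟨ cong (λ l → + l ℤ.+ -[1+ 0 ] ℤ.* + N) L≡M+N ⟨
      + L ℤ.+ -[1+ 0 ] ℤ.* + N
        ≡⟨ cong₂ (λ a b → a ℤ.+ -[1+ 0 ] ℤ.* b) eqL eqN ⟩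
      Σℤ (weight p) (paths r) ℤ.+ -[1+ 0 ] ℤ.* Σℤ (weight p) (paths s)
        ≡⟨ cong (ℤ._+_ (Σℤ (weight p) (paths r))) (begin
             -[1+ 0 ] ℤ.* Σℤ (weight p) (paths s)
               ≡⟨ Σℤ-*ˡ -[1+ 0 ] (weight p) (paths s) ⟨
             Σℤ (λ π → -[1+ 0 ] ℤ.* weight p π) (paths s)
               ≡⟨ Σℤ-cong (paths s) (λ {π} _ → weight-grow p y (proj₁ π) (proj₂ π)) ⟨
             Σℤ (λ (e , fs) → weight p (y ∷ e , fs)) (paths s)
               ≡⟨ Σℤ-map (weight p) _ (paths s) ⟨
             Σℤ (weight p) (map (λ (e , fs) → y ∷ e , fs) (paths s)) ∎) ⟩
      Σℤ (weight p) (paths r) ℤ.+ Σℤ (weight p) (map (λ (e , fs) → y ∷ e , fs) (paths s))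
        ≡⟨ Σℤ-++ (weight p) (paths r) _ ⟨
      Σℤ (weight p) (paths (grow r s)) ∎)
    where
    open ≡-Reasoning
    perm : A ++ y ∷ B ↭ y ∷ (A ++ nbrs y B) ++ nonNbrs y B
    perm = ↭-trans (shift y A B) (prep y (↭-sym (take-nbrs y A B)))
    y∉ : y ∉ (A ++ nbrs y B) ++ nonNbrs y B
    y∉ = Unique-head (Unique-↭ (prep y (↭-sym (take-nbrs y A B))) U)
    N⊆ : ∀ {a} → a ∈ (A ++ nbrs y B) ++ nonNbrs y B → Adj y a → a ∈ A ++ nbrs y B
    N⊆ i e with ∈-++⁻ A (∈-resp-↭ (take-nbrs y A B) i)
    ... | inj₁ j = ∈-++⁺ˡ j
    ... | inj₂ j = ∈-++⁺ʳ A (∈-filter⁺ (Adj? y) j e)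
    ⊆N : ∀ {a} → a ∈ A ++ nbrs y B → a ∈ A ⊎ (a ∈ (A ++ nbrs y B) ++ nonNbrs y B × Adj y a)
    ⊆N i with ∈-++⁻ A i
    ... | inj₁ j = inj₁ j
    ... | inj₂ j = inj₂ (∈-++⁺ˡ i , proj₂ (∈-filter⁻ (Adj? y) {xs = B} j))
    L≡M+N : L ≡ M ℕ.+ N
    L≡M+N = Card-split (λ c → lookup c y Fin.≟ Fin.zero) cardL cardM (Card-resp
      (λ c → insert-zero perm y∉ ∈-++⁺ˡ N⊆) (λ c (col , e) → remove-zero perm ⊆N col e) cardN)

  chromatic-polynomial : ∀ {P} → IsChromaticPolynomial G P → ∀ p →
    eval P (+ suc p) ≡ Σℤ (λ π → sign π ℤ.* (+ suc p) ℤ.^ degree π) (paths (run [] (allFin n)))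
  chromatic-polynomial chi p with chi (suc p) | colouring-count p (run [] (allFin n)) (Unique.allFin⁺ n)
  ... | N , card , eq | M , card′ , eq′ = trans eq (trans (cong +_ N≡M) eq′)
    where
    N≡M : N ≡ M
    N≡M = Card-unique card (Card-resp
      (λ c col a b → proper col (∈-allFin a) (∈-allFin b))
      (λ c pr → colouring (λ {a} {b} _ _ → pr a b) (λ ()) (λ {a} a∉ → contradiction (∈-allFin a) a∉)) card′)

  -- Acyclic orientations

  before⇒bef : ∀ {a b} w → b ∈ w → a ≢ b → T (before G w a b) → Bef w a b
  before⇒bef {a} {b} (x ∷ w) i a≢b t with x Fin.≟ a | x Fin.≟ b | i
  ... | yes refl | _        | here refl = contradiction refl a≢b
  -- `before` answers true as soon as `a` is met; that `b` comes later has to be read off from its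
  -- membership.
  ... | yes refl | _        | there j   = here j
  ... | no _     | no x≢b   | here refl = contradiction refl x≢b
  ... | no _     | no _     | there j   = there (before⇒bef w j a≢b t)

  bef⇒before : ∀ {a b w} → Unique w → Bef w a b → T (before G w a b)
  bef⇒before {a} {b} {x ∷ w} U p with x Fin.≟ a | x Fin.≟ b | p
  ... | yes _   | _        | _       = tt
  ... | no x≢a  | _        | here _  = contradiction refl x≢a
  ... | no _    | yes refl | there q = contradiction (bef-∈ʳ q) (Unique-head U)
  bef⇒before {w = x ∷ w} (_ ∷ U) p | no _ | no _ | there q = bef⇒before U q

  multilinear-∈ : ∀ {w} → Multilinear G w → ∀ a → a ∈ w
  multilinear-∈ perm a = ∈-resp-↭ (↭-sym perm) (∈-allFin a)

  multilinear-unique : ∀ {w} → Multilinear G w → Unique w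
  multilinear-unique perm = Unique-↭ (↭-sym perm) (Unique.allFin⁺ n)

  orientOf-entry : ∀ w a b → lookup (lookup (orientOf G w) a) b ≡ adj G a b ∧ before G w a b
  orientOf-entry w a b =
    trans (cong (λ r → lookup r b) (lookup∘tabulate _ a)) (lookup∘tabulate _ b)

  orientOf-⊑ : ∀ {u v} → Multilinear G u → Multilinear G v → orientOf G u ≡ orientOf G v → u ⊑ v
  orientOf-⊑ {u} {v} mu mv eq = (λ {a} _ → multilinear-∈ mv a) , ord
    where
    ord : ∀ {a b} → Adj a b → Bef u a b → Bef v a b
    ord {a} {b} e p = before⇒bef v (multilinear-∈ mv b) (λ { refl → Adj-irrefl e })
      (same e (trans (≡-sym (orientOf-entry u a b))
                     (trans (cong (λ o → lookup (lookup o a) b) eq) (orientOf-entry v a b)))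
              (bef⇒before (multilinear-unique mu) p))
      where
      same : ∀ {x y z} → T x → x ∧ y ≡ x ∧ z → T y → T z
      same {true} _ refl t = t

  orientOf-injective : ∀ {u v} → Multilinear G u → Multilinear G v → orientOf G u ≡ orientOf G v → u ≈ v
  orientOf-injective mu mv eq = orientOf-⊑ mu mv eq , orientOf-⊑ mv mu (≡-sym eq)

  orientOf-cong : ∀ {u v} → Multilinear G u → Multilinear G v → u ≈ v → orientOf G u ≡ orientOf G v
  orientOf-cong {u} {v} mu mv (f , g) = tabulate-cong λ a → tabulate-cong λ b →
    ∧-congˡ λ e → T-ext (transfer mu mv f e) (transfer mv mu g e)
    where
    ∧-congˡ : ∀ {x y z} → (T x → y ≡ z) → x ∧ y ≡ x ∧ z
    ∧-congˡ {true}  h = h tt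
    ∧-congˡ {false} h = refl
    transfer : ∀ {u v a b} → Multilinear G u → Multilinear G v → u ⊑ v → Adj a b →
               T (before G u a b) → T (before G v a b)
    transfer {u} {b = b} mu mv f e t = bef⇒before (multilinear-unique mv)
      (order f e (before⇒bef u (multilinear-∈ mu b) (λ { refl → Adj-irrefl e }) t))

  Labels : Set
  Labels = Vec ℕ n

  -- Labellings

  LabelCond-local : ∀ {m lam k f g} j es → (∀ {a} → a ∈ concat es → lookup f a ≡ lookup g a) →
                    LabelCond G m lam k f j es → LabelCond G m lam k g j es
  LabelCond-local j []       eq _ = _
  LabelCond-local {f = f} {g} j (e ∷ es) eq (const , range , rest) =
    (λ a b i k → trans (≡-sym (eq (∈-++⁺ˡ i))) (trans (const a b i k) (eq (∈-++⁺ˡ k)))) ,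
    (λ a i → let (lo , hi , hi′) = range a i ; h = eq (∈-++⁺ˡ i) in
      subst (1 ℕ.≤_) h lo ,
      (λ le → subst (ℕ._≤ _) h (hi le)) ,
      (λ lt → subst (ℕ._≤ _) h (hi′ lt))) ,
    LabelCond-local (suc j) es (eq ∘ ∈-++⁺ʳ e) rest

  LabelCond-≋ : ∀ {m lam k f} j {es es′} → es ≋ es′ → LabelCond G m lam k f j es → LabelCond G m lam k f j es′
  LabelCond-≋ j []             _                      = _
  LabelCond-≋ j ((_ , g) ∷ es) (const , range , rest) =
    (λ a b i k → const a b (letters g i) (letters g k)) ,
    (λ a i → range a (letters g i)) ,
    LabelCond-≋ (suc j) es rest

  relabel-at : ∀ {P : Set} → Dec P → ℕ → ℕ → ℕ
  relabel-at (yes _) v l = v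
  relabel-at (no _)  v l = l

  relabel : W → ℕ → Labels → Labels
  relabel e v f = tabulate (λ a → relabel-at (a ∈? e) v (lookup f a))

  relabel-∈ : ∀ {e a} v f → a ∈ e → lookup (relabel e v f) a ≡ v
  relabel-∈ {e} {a} v f a∈e = trans (lookup∘tabulate _ a) (at (a ∈? e))
    where
    at : (d : Dec (a ∈ e)) → relabel-at d v (lookup f a) ≡ v
    at (yes _)  = refl
    at (no a∉e) = contradiction a∈e a∉e

  relabel-∉ : ∀ {e a} v f → a ∉ e → lookup (relabel e v f) a ≡ lookup f a
  relabel-∉ {e} {a} v f a∉e = trans (lookup∘tabulate _ a) (at (a ∈? e))
    where
    at : (d : Dec (a ∈ e)) → relabel-at d v (lookup f a) ≡ lookup f a
    at (yes a∈e) = contradiction a∈e a∉e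
    at (no _)    = refl

  -- Fixing the label 0 outside the given factors makes the vector determined by its labels on these
  -- factors, so that partial labellings can be counted.
  Supported : List W → Labels → Set
  Supported es f = ∀ {a} → a ∉ concat es → lookup f a ≡ 0

  data Nonempty : W → Set where
    nonempty : ∀ {x t} → Nonempty (x ∷ t)

  -- The number of admissible labels of the j-th of k factors, where r = k - j + 1.
  bound : (lam m r : ℕ) → ℕ
  bound lam zero    r = lam
  bound lam (suc _) r = r

  powDerivℕ-bound : ∀ lam m r → powDerivℕ lam m (suc r) ≡ bound lam m (suc r) ℕ.* powDerivℕ lam (ℕ.pred m) r
  powDerivℕ-bound lam zero    r = refl
  powDerivℕ-bound lam (suc m) r = refl

  -- The factors are labelled independently. The factor after the first `i` of `k` has k - i labels
  -- if i < m and `lam` labels otherwise; multiplying these numbers is the recursion of `powDerivℕ`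
  -- with m - i derivatives left.
  label-count : ∀ {m lam k} i es → k ≡ i ℕ.+ length es → m ℕ.≤ k → Unique (concat es) → All Nonempty es →
    Card (λ f → LabelCond G m lam k f (suc i) es × Supported es f) (powDerivℕ lam (m ℕ.∸ i) (length es))
  label-count {m} {lam} i [] refl m≤k U _
    rewrite ℕ.+-identityʳ i | ℕ.m≤n⇒m∸n≡0 m≤k =
    Card-singleton (replicate n 0) (_ , λ {a} _ → lookup-replicate a 0)
      (λ f (_ , out) → vec-ext λ a → trans (out λ ()) (≡-sym (lookup-replicate a 0)))
  label-count {m} {lam} {k} i (e@(x ∷ _) ∷ es) k≡ m≤k U (nonempty ∷ ne) =
    subst (Card _) count (Card-resp admissible label
      -- Labels run from 1 to `β`, so the entry `v` of `upTo β` stands for the label `suc v`.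
      (Card-Any {R = R} (upTo β) (All.tabulate λ {v} _ → card v)
        (AllPairs.map (λ u≢v f (eq , _) (eq′ , _) →
          u≢v (ℕ.suc-injective (trans (≡-sym (eq (here refl))) (eq′ (here refl))))) (Unique.upTo⁺ β))))
    where
    r β N : ℕ
    r = length es
    β = bound lam (m ℕ.∸ i) (suc r)
    N = powDerivℕ lam (m ℕ.∸ suc i) r
    tail-k : k ≡ suc i ℕ.+ r
    tail-k = trans k≡ (ℕ.+-suc i r)
    Rest : Labels → Set
    Rest f = LabelCond G m lam k f (suc (suc i)) es × Supported es f
    R : ℕ → Labels → Set
    R v f = (∀ {a} → a ∈ e → lookup f a ≡ suc v) ×
            LabelCond G m lam k f (suc (suc i)) es × Supported (e ∷ es) f
    disjoint : ∀ {a} → a ∈ concat es → a ∉ e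
    disjoint j i = Unique-disjoint e U i j
    tailCard : Card Rest N
    tailCard = label-count (suc i) es tail-k m≤k (Unique-++⁻ʳ e U) ne
    card : ∀ v → Card (R v) N
    card v = Card-image (relabel e (suc v)) (relabel e 0) forth back tailCard
      where
      forth : ∀ f → Rest f → R v (relabel e (suc v) f) × relabel e 0 (relabel e (suc v) f) ≡ f
      forth f (lc , out) =
        (relabel-∈ (suc v) f ,
         LabelCond-local (suc (suc i)) es (λ j → ≡-sym (relabel-∉ (suc v) f (disjoint j))) lc ,
         (λ a∉ → trans (relabel-∉ (suc v) f (a∉ ∘ ∈-++⁺ˡ)) (out (a∉ ∘ ∈-++⁺ʳ e)))) ,
        vec-ext inverse
        where
        inverse : ∀ a → lookup (relabel e 0 (relabel e (suc v) f)) a ≡ lookup f a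
        inverse a with a ∈? e
        ... | yes a∈e = trans (relabel-∈ 0 (relabel e (suc v) f) a∈e) (≡-sym (out λ j → disjoint j a∈e))
        ... | no a∉e  = trans (relabel-∉ 0 (relabel e (suc v) f) a∉e) (relabel-∉ (suc v) f a∉e)
      back : ∀ f → R v f → Rest (relabel e 0 f) × relabel e (suc v) (relabel e 0 f) ≡ f
      back f (eq , lc , out) =
        (LabelCond-local (suc (suc i)) es (λ j → ≡-sym (relabel-∉ 0 f (disjoint j))) lc , out′) ,
        vec-ext inverse
        where
        out′ : Supported es (relabel e 0 f)
        out′ {a} a∉es with a ∈? e
        ... | yes a∈e = relabel-∈ 0 f a∈e
        ... | no a∉e  = trans (relabel-∉ 0 f a∉e) (out ([ a∉e , a∉es ]′ ∘ ∈-++⁻ e))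
        inverse : ∀ a → lookup (relabel e (suc v) (relabel e 0 f)) a ≡ lookup f a
        inverse a with a ∈? e
        ... | yes a∈e = trans (relabel-∈ (suc v) (relabel e 0 f) a∈e) (≡-sym (eq a∈e))
        ... | no a∉e  = trans (relabel-∉ (suc v) (relabel e 0 f) a∉e) (relabel-∉ 0 f a∉e)
    -- The factor has the 1-based index j = i + 1, so the bound k - j + 1 counts it together with
    -- the `r` factors after it.
    k∸ : k ℕ.∸ suc i ℕ.+ 1 ≡ suc r
    k∸ = trans (cong (λ z → z ℕ.∸ suc i ℕ.+ 1) tail-k)
               (trans (cong (ℕ._+ 1) (ℕ.m+n∸m≡n (suc i) r)) (ℕ.+-comm r 1))
    bounded : ∀ {l} → (suc i ℕ.≤ m → l ℕ.≤ k ℕ.∸ suc i ℕ.+ 1) → (m ℕ.< suc i → l ℕ.≤ lam) → l ℕ.≤ β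
    bounded {l} h h′ with m ℕ.∸ i in eq
    ... | zero  = h′ (ℕ.s≤s (ℕ.m∸n≡0⇒m≤n eq))
    ... | suc _ = subst (l ℕ.≤_) k∸ (h (ℕ.m∸n≢0⇒n<m λ z → ℕ.1+n≢0 (trans (≡-sym eq) z)))
    unbounded : ∀ {l} → l ℕ.≤ β → (suc i ℕ.≤ m → l ℕ.≤ k ℕ.∸ suc i ℕ.+ 1) × (m ℕ.< suc i → l ℕ.≤ lam)
    unbounded {l} le with m ℕ.∸ i in eq
    ... | zero  = (λ i<m → contradiction i<m (ℕ.≤⇒≯ (ℕ.m∸n≡0⇒m≤n eq))) , (λ _ → le)
    ... | suc _ = (λ _ → subst (l ℕ.≤_) (≡-sym k∸) le) ,
                  (λ m<1+i → contradiction (trans (≡-sym eq) (ℕ.m≤n⇒m∸n≡0 (ℕ.≤-pred m<1+i))) λ ())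
    admissible : ∀ f → Any (λ v → R v f) (upTo β) →
                 LabelCond G m lam k f (suc i) (e ∷ es) × Supported (e ∷ es) f
    admissible f any with find any
    ... | v , v∈ , eq , lc , out =
      ((λ a b i j → trans (eq i) (≡-sym (eq j))) ,
       (λ a i → let (h , h′) = unbounded (subst (ℕ._≤ β) (≡-sym (eq i)) (∈-upTo⁻ v∈)) in
         subst (1 ℕ.≤_) (≡-sym (eq i)) (ℕ.s≤s ℕ.z≤n) , h , h′) ,
       lc) , out
    label : ∀ f → LabelCond G m lam k f (suc i) (e ∷ es) × Supported (e ∷ es) f → Any (λ v → R v f) (upTo β)
    label f ((const , range , lc) , out) with lookup f x in fx | range x (here refl)
    ... | zero  | () , _
    ... | suc v | _ , h , h′ = lose (∈-upTo⁺ (bounded h h′))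
      ((λ j → trans (const _ x j (here refl)) fx) , lc , out)
    count : sum (map (λ _ → N) (upTo β)) ≡ powDerivℕ lam (m ℕ.∸ i) (suc r)
    count = trans (sum-const (upTo β) N) (trans (cong (ℕ._* N) (length-upTo β))
      (trans (cong (λ z → β ℕ.* powDerivℕ lam z r) (≡-sym (ℕ.pred[m∸n]≡m∸[1+n] m i)))
             (≡-sym (powDerivℕ-bound lam (m ℕ.∸ i) r))))

  -- Counting labelled acyclic orientations

  ≋-concat : ∀ {fs gs} → fs ≋ gs → concat fs ≈ concat gs
  ≋-concat []       = ≈-refl
  ≋-concat (e ∷ es) = ≈-++ e (≋-concat es)

  reverseFactors-nonempty : ∀ {fs} → ReverseFactors fs → All Nonempty fs
  reverseFactors-nonempty []          = []
  reverseFactors-nonempty (fac _ _ F) = nonempty ∷ reverseFactors-nonempty F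

  -- Every letter either is the head of its factor or is counted by `excess`. This turns the
  -- exponent of the sign into n minus the number of factors.
  excess-length : ∀ {fs} → ReverseFactors fs → length fs ℕ.+ excess fs ≡ length (concat fs)
  excess-length [] = refl
  excess-length (fac {t = t} {fs} _ _ F) = cong suc (begin
    length fs ℕ.+ (length t ℕ.+ excess fs) ≡⟨ ℕ.+-comm (length fs) _ ⟩
    length t ℕ.+ excess fs ℕ.+ length fs   ≡⟨ ℕ.+-assoc (length t) _ _ ⟩
    length t ℕ.+ (excess fs ℕ.+ length fs) ≡⟨ cong (length t ℕ.+_) (ℕ.+-comm (excess fs) _) ⟩
    length t ℕ.+ (length fs ℕ.+ excess fs) ≡⟨ cong (length t ℕ.+_) (excess-length F) ⟩
    length t ℕ.+ length (concat fs)        ≡⟨ length-++ t ⟨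
    length (t ++ concat fs)                ∎)
    where open ≡-Reasoning

  allPaths : List Path
  allPaths = paths (run [] (allFin n))

  word : List W → W
  word fs = concat (reverse fs)

  -- The full run starts without candidates, so the rest of the current factor has no minimal piece
  -- and is empty. Such a path is a multilinear heap with its Lyndon factorization.
  record CompletePath (π : Path) : Set where
    field
      closed      : proj₁ π ≡ []
      factors     : ReverseFactors (proj₂ π)
      multilinear : Multilinear G (concat (proj₂ π))

    word-multilinear : Multilinear G (word (proj₂ π))
    word-multilinear = subst (_↭ allFin n) (≡-sym (concat-reverse (proj₂ π)))
      (↭-trans (assemble-↭ (proj₂ π)) multilinear)

  complete-path : ∀ {π} → π ∈ allPaths → CompletePath π
  complete-path {e , fs} i with paths-sound (run [] (allFin n)) i
  ... | perm , roots , F with no-src⇒[] (Unique-++⁻ˡ e (Unique-↭ (↭-sym perm) (Unique.allFin⁺ n)))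
                                     (λ s → contradiction (roots s) λ ())
  ... | refl = record { closed = refl ; factors = F ; multilinear = perm }

  degree≤n : ∀ {π} → π ∈ allPaths → degree π ℕ.≤ n × sign π ≡ -1^ (n ℕ.∸ degree π)
  degree≤n {e , fs} i with complete-path i
  ... | record { closed = refl ; factors = F ; multilinear = perm } =
    ℕ.m+n≤o⇒m≤o (length fs) (ℕ.≤-reflexive total) ,
    cong -1^_ (trans (≡-sym (ℕ.m+n∸m≡n (length fs) (excess fs))) (cong (ℕ._∸ length fs) total))
    where
    total : length fs ℕ.+ excess fs ≡ n
    total = trans (excess-length F) (trans (↭-length perm) (length-tabulate {n = n} (λ a → a)))

  LabelledPath : (m lam : ℕ) → Path → Orientation G × Labels → Set
  LabelledPath m lam (_ , fs) (O , f) =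
    O ≡ orientOf G (word fs) × m ℕ.≤ length fs × LabelCond G m lam (length fs) f 1 (reverse fs)

  -- The path fixes the orientation, so only the labels vary. If `m` exceeds the number of factors
  -- there is no labelling and the derivative is 0.
  labelledPath-count : ∀ m lam {π} → π ∈ allPaths → Card (LabelledPath m lam π) (powDerivℕ lam m (degree π))
  labelledPath-count m lam {e , fs} i with complete-path i | m ℕ.≤? length fs
  ... | _ | no m≰k = subst (Card _) (≡-sym (powDerivℕ-vanishes lam (ℕ.≰⇒> m≰k)))
    (Card-∅ λ _ (_ , m≤k , _) → m≰k m≤k)
  ... | c | yes m≤k = Card-image (orientOf G (word fs) ,_) proj₂
    (λ f (lc , _) → (refl , m≤k , lc) , refl)
    (λ { (_ , f) (refl , _ , lc) → (lc , λ {a} a∉ → contradiction (multilinear-∈ word-multilinear a) a∉) , refl })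
    (subst (λ k → Card (λ f → LabelCond G m lam (length fs) f 1 (reverse fs) × Supported (reverse fs) f)
                       (powDerivℕ lam m k))
      (length-reverse fs)
      (label-count 0 (reverse fs) (≡-sym (length-reverse fs)) m≤k (multilinear-unique word-multilinear)
        (All-resp-↭ (↭-sym (↭-reverse fs)) (reverseFactors-nonempty factors))))
    where
    open CompletePath c

  -- Equal orientations give equal heaps, and a heap has only one Lyndon factorization, whereas
  -- different paths have different ones.
  labelledPaths-disjoint : ∀ m lam →
    AllPairs (λ π ρ → ∀ x → LabelledPath m lam π x → ¬ LabelledPath m lam ρ x) allPaths
  labelledPaths-disjoint m lam = AllPairs-∈ disjoint (paths-distinct (run [] (allFin n)) (Unique.allFin⁺ n))
    where
    disjoint : ∀ {π ρ} → π ∈ allPaths → ρ ∈ allPaths → Distinct π ρ →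
               ∀ x → LabelledPath m lam π x → ¬ LabelledPath m lam ρ x
    disjoint {e , fs} {e′ , gs} i j d _ (refl , _) (eq , _) with complete-path i | complete-path j
    ... | c@record { closed = refl } | c′@record { closed = refl } = d ≈-refl
      (factors-unique C.factors C′.factors (unique fs C.multilinear) (unique gs C′.multilinear)
        (subst₂ _≈_ (concat-reverse fs) (concat-reverse gs)
          (orientOf-injective C.word-multilinear C′.word-multilinear eq)))
      where
      module C = CompletePath c
      module C′ = CompletePath c′
      unique : ∀ fs → Multilinear G (concat fs) → Unique (assemble fs)
      unique fs perm = multilinear-unique (↭-trans (assemble-↭ fs) perm)

  labelledPath⇒AO : ∀ m lam {π} → π ∈ allPaths → ∀ x → LabelledPath m lam π x → IsLabelledAO G m lam x
  labelledPath⇒AO m lam {e , fs} i (O , f) (eq , m≤k , lc) =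
    word fs , word-multilinear , eq , reverse fs ,
    (ε , reverse-factors factors (multilinear-unique multilinear)) ,
    subst (m ℕ.≤_) (≡-sym (length-reverse fs)) m≤k ,
    subst (λ k → LabelCond G m lam k f 1 (reverse fs)) (≡-sym (length-reverse fs)) lc
    where
    open CompletePath (complete-path i)

  -- The given factorization occurs on a path only up to commutations within each factor; neither
  -- the orientation nor the label conditions see that difference.
  AO⇒labelledPath : ∀ m lam x → IsLabelledAO G m lam x → Any (λ π → LabelledPath m lam π x) allPaths
  AO⇒labelledPath m lam (O , f) (w , mw , eq , es , (w≃ , L) , m≤k , lc)
    with paths-complete (run [] (allFin n)) {[]} {reverse es} U perm (λ { (() , _) }) (factors-reverse L Ues)
    where
    mes : Multilinear G (concat es)
    mes = ↭-trans (↭-sym (≃⇒↭ w≃)) mw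
    Ues : Unique (concat es)
    Ues = multilinear-unique mes
    perm : concat (reverse es) ↭ allFin n
    perm = ↭-trans (subst (_↭ concat es) (≡-sym (concat-reverse es)) (assemble-↭ es)) mes
    U : Unique (concat (reverse es))
    U = multilinear-unique perm
  ... | e , fs , i , _ , fs≋ = lose i
    (trans eq (orientOf-cong mw (CompletePath.word-multilinear (complete-path i))
       (≈-trans (≃⇒≈ w≃) (≈-sym (≋-concat es≋)))) ,
     subst (m ℕ.≤_) (≡-sym len) m≤k ,
     subst (λ k → LabelCond G m lam k f 1 (reverse fs)) (≡-sym len)
       (LabelCond-≋ 1 (Pointwise.symmetric ≈-sym es≋) lc))
    where
    es≋ : reverse fs ≋ es
    es≋ = subst (reverse fs ≋_) (reverse-involutive es) (Pointwise.reverse⁺ fs≋)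
    len : length fs ≡ length es
    len = trans (Pointwise-length fs≋) (length-reverse es)

  labelled-count : ∀ m lam →
    Card (IsLabelledAO G m lam) (sum (map (λ π → powDerivℕ lam m (degree π)) allPaths))
  labelled-count m lam = Card-resp
    (λ x any → let (π , i , l) = find any in labelledPath⇒AO m lam i x l)
    (AO⇒labelledPath m lam)
    (Card-Any allPaths (All.tabulate (labelledPath-count m lam)) (labelledPaths-disjoint m lam))

  -- Term by term, the global sign and the sign of the path cancel against the sign of the
  -- derivative at the negative argument, leaving the number of labellings of the path.
  chiTilde-count : ∀ P → IsChromaticPolynomial G P → ∀ m lam →
    chiTilde n m P (+ lam) ≡ + sum (map (λ π → powDerivℕ lam m (degree π)) allPaths)
  chiTilde-count P chi m lam = begin
    s ℤ.* eval (derivN m P) (- + lam)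
      ≡⟨ cong (s ℤ.*_) (eval-derivN-agree P sign degree allPaths (chromatic-polynomial {P} chi) m (- + lam)) ⟩
    s ℤ.* Σℤ (λ π → sign π ℤ.* powDeriv (- + lam) m (degree π)) allPaths
      ≡⟨ Σℤ-*ˡ s _ allPaths ⟨
    Σℤ (λ π → s ℤ.* (sign π ℤ.* powDeriv (- + lam) m (degree π))) allPaths
      ≡⟨ Σℤ-cong allPaths cancel ⟩
    Σℤ (λ π → + powDerivℕ lam m (degree π)) allPaths
      ≡⟨ Σℤ-sum (λ π → powDerivℕ lam m (degree π)) allPaths ⟩
    + sum (map (λ π → powDerivℕ lam m (degree π)) allPaths) ∎
    where
    open ≡-Reasoning
    s : ℤ
    s = -1^ (n ℕ.∸ m)
    cancel : ∀ {π} → π ∈ allPaths →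
             s ℤ.* (sign π ℤ.* powDeriv (- + lam) m (degree π)) ≡ + powDerivℕ lam m (degree π)
    cancel {π} i = let (le , eq) = degree≤n i in
      trans (cong (λ z → s ℤ.* (z ℤ.* powDeriv (- + lam) m (degree π))) eq) (signs-cancel lam n m (degree π) le)

theorem1p10 : (n : ℕ) (G : Graph n) (lam : ℕ) → 1 ≤ lam → (m : ℕ) → m ≤ n →
    (P : Poly) → IsChromaticPolynomial G P →
    Σ ℕ λ N → Card (IsLabelledAO G m lam) N × chiTilde n m P (+ lam) ≡ + N
theorem1p10 n G lam _ m _ P chi = _ , labelled-count G m lam , chiTilde-count G P chi m lam
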